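{- For all integers $r\ge 1$ and $s\ge 2$, $\chi_{ltna}(rK_2\vee W_{2s})=5$.
   Context: All graphs are finite and simple. $rK_2$ is the disjoint union of $r$ copies of $K_2$. $W_{2s}$ is the wheel of order $2s+1$: $V(W_{2s})=\{v_j\mid 1\le j\le 2s+1\}$ and $E(W_{2s})=\{v_1v_{2s}\}\cup\{v_jv_{j+1}\mid 1\le j\le 2s-1\}\cup\{v_jv_{2s+1}\mid 1\le j\le 2s\}$. The join $G\vee H$ of (vertex-disjoint) graphs has $V(G\vee H)=V(G)\cup V(H)$ and $E(G\vee H)=E(G)\cup E(H)\cup\{uv\mid u\in V(G),v\in V(H)\}$. For a graph $G=(V,E)$ of order $p$ and size $q$ without isolated vertices, a bijection $f:V\cup E\to\{1,\dots,p+q\}$ is a local total neighborhood antimagic labeling of $G$ if the induced vertex coloring $f^+_{tn}(u)=\sum_{ux\in E}[f(ux)+f(x)]$ satisfies $f^+_{tn}(u)\ne f^+_{tn}(v)$ for every edge $uv\in E$. The number of distinct induced colors is $c_{tn}(f)$. The local total neighborhood antimagic chromatic number $\chi_{ltna}(G)$ is the minimum of $c_{tn}(f)$ over all local total neighborhood antimagic labelings $f$ of $G$; an assertion $\chi_{ltna}(G)=k$ includes the assertion that $G$ admits such a labeling. -}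

module Defs where

open import Data.Fin as Fin using (Fin; toℕ)
open import Data.Fin.Properties using (+↔⊎; *↔×)
open import Data.List using (length; filter; deduplicate; tabulate; allFin; cartesianProduct)
open import Data.Nat using (ℕ; suc; _+_; _*_; _≤_; _<_; _≟_; _<?_; _≤?_)
open import Data.Nat.Properties using (+-0-commutativeMonoid; +-suc; suc-injective; <-irrefl; 1+n≢n)
open import Algebra.Properties.CommutativeMonoid.Sum +-0-commutativeMonoid using (sum)
open import Data.Product using (_×_; _,_; ∃-syntax)
open import Data.Product.Function.NonDependent.Propositional using (_×-↔_)
open import Data.Sum using (_⊎_; inj₁; inj₂; swap)
open import Data.Sum.Function.Propositional using (_⊎-↔_)
open import Data.Sum.Relation.Binary.Pointwise using (_⊎ₛ_)
open import Data.Unit using (⊤; tt)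
open import Function using (_∘_)
open import Function.Bundles using (_↔_; Inverse; Bijection)
open import Function.Properties.Inverse using (↔-refl; ↔-sym; ↔-trans)
open import Level using (0ℓ)
open import Relation.Binary.Bundles using (Setoid)
open import Relation.Binary.Core using (Rel)
open import Relation.Binary.Definitions using (Decidable; Symmetric)
open import Relation.Binary.PropositionalEquality
  using (_≡_; _≢_; refl; sym; trans; setoid; ≢-sym)
open import Relation.Nullary using (¬_; Dec; yes; no)
open import Relation.Nullary.Decidable using (¬?; _×-dec_; _⊎-dec_)

record Graph : Set₁ where
  infix 4 _~_ _~?_
  field
    V       : Set
    order   : ℕ
    enum    : Fin order ↔ V
    _~_     : Rel V 0ℓ
    _~?_    : Decidable _~_
    ~-sym   : Symmetric _~_
    ~-irrefl : ∀ {u} → ¬ (u ~ u)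

  vertex : Fin order → V
  vertex = Inverse.to enum

  size : ℕ
  size = length (filter (λ (i , j) → (i Fin.<? j) ×-dec (vertex i ~? vertex j))
                        (cartesianProduct (allFin order) (allFin order)))

  NoIsolatedVertices : Set
  NoIsolatedVertices = ∀ u → ∃[ v ] u ~ v

  -- An edge is stored with an orientation; _≈ᴱ_ forgets the orientation (and
  -- the adjacency proof), so that edges up to _≈ᴱ_ are unordered pairs.
  record Edge : Set where
    constructor mkEdge
    field
      {end₁ end₂} : V
      adjacent    : end₁ ~ end₂

  open Edge

  infix 4 _≈ᴱ_
  _≈ᴱ_ : Rel Edge 0ℓ
  e ≈ᴱ e′ = (end₁ e ≡ end₁ e′ × end₂ e ≡ end₂ e′)
          ⊎ (end₁ e ≡ end₂ e′ × end₂ e ≡ end₁ e′)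

  edgeSetoid : Setoid 0ℓ 0ℓ
  edgeSetoid = record
    { Carrier       = Edge
    ; _≈_           = _≈ᴱ_
    ; isEquivalence = record
      { refl  = inj₁ (refl , refl)
      ; sym   = λ where
          (inj₁ (p , q)) → inj₁ (sym p , sym q)
          (inj₂ (p , q)) → inj₂ (sym q , sym p)
      ; trans = λ where
          (inj₁ (p , q)) (inj₁ (p′ , q′)) → inj₁ (trans p p′ , trans q q′)
          (inj₁ (p , q)) (inj₂ (p′ , q′)) → inj₂ (trans p p′ , trans q q′)
          (inj₂ (p , q)) (inj₁ (p′ , q′)) → inj₂ (trans p q′ , trans q p′)
          (inj₂ (p , q)) (inj₂ (p′ , q′)) → inj₁ (trans p q′ , trans q p′)
      }
    }

-- i : Fin (p + q) stands for the label i + 1 in {1, …, p + q}.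
TotalLabeling : Graph → Set
TotalLabeling G = Bijection (setoid V ⊎ₛ edgeSetoid) (setoid (Fin (order + size)))
  where open Graph G

module _ (G : Graph) (f : TotalLabeling G) where
  open Graph G

  label : V ⊎ Edge → ℕ
  label = suc ∘ toℕ ∘ Bijection.to f

  summand : ∀ {u x} → Dec (u ~ x) → ℕ
  summand {x = x} (yes u~x) = label (inj₂ (mkEdge u~x)) + label (inj₁ x)
  summand         (no  _)   = 0

  f⁺tn : V → ℕ
  f⁺tn u = sum (λ i → summand (u ~? vertex i))

  IsLocalTotalNeighborhoodAntimagic : Set
  IsLocalTotalNeighborhoodAntimagic = ∀ {u v} → u ~ v → f⁺tn u ≢ f⁺tn v

  ctn : ℕ
  ctn = length (deduplicate _≟_ (tabulate (f⁺tn ∘ vertex)))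

-- χltna is the minimum of ctn, given as a relation because it is
-- undefined for graphs admitting no labeling.
record χltna_is_ (G : Graph) (k : ℕ) : Set where
  field
    noIsolatedVertices : Graph.NoIsolatedVertices G
    attained : ∃[ f ] (IsLocalTotalNeighborhoodAntimagic G f × ctn G f ≡ k)
    minimal  : ∀ f → IsLocalTotalNeighborhoodAntimagic G f → k ≤ ctn G f

K : ℕ → Graph
K n = record
  { V = Fin n
  ; order = n
  ; enum = ↔-refl
  ; _~_ = _≢_
  ; _~?_ = λ u v → ¬? (u Fin.≟ v)
  ; ~-sym = ≢-sym
  ; ~-irrefl = λ u≢u → u≢u refl
  }

infixr 7 _copiesOf_
_copiesOf_ : ℕ → Graph → Graph
r copiesOf G = record
  { V = Fin r × V
  ; order = r * order
  ; enum = ↔-trans *↔× (↔-refl ×-↔ enum)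
  ; _~_ = λ (i , u) (j , v) → i ≡ j × u ~ v
  ; _~?_ = λ (i , u) (j , v) → (i Fin.≟ j) ×-dec (u ~? v)
  ; ~-sym = λ (i≡j , u~v) → sym i≡j , ~-sym u~v
  ; ~-irrefl = λ (_ , u~u) → ~-irrefl u~u
  }
  where open Graph G

infixr 6 _∨_
_∨_ : Graph → Graph → Graph
G ∨ H = record
  { V = G.V ⊎ H.V
  ; order = G.order + H.order
  ; enum = ↔-trans +↔⊎ (G.enum ⊎-↔ H.enum)
  ; _~_ = adj
  ; _~?_ = adj?
  ; ~-sym = λ {x} {y} → adj-sym x y
  ; ~-irrefl = λ {x} → adj-irrefl x
  }
  where
  module G = Graph G
  module H = Graph H

  adj : Rel (G.V ⊎ H.V) 0ℓ
  adj (inj₁ u) (inj₁ v) = u G.~ v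
  adj (inj₂ u) (inj₂ v) = u H.~ v
  adj (inj₁ _) (inj₂ _) = ⊤
  adj (inj₂ _) (inj₁ _) = ⊤

  adj? : Decidable adj
  adj? (inj₁ u) (inj₁ v) = u G.~? v
  adj? (inj₂ u) (inj₂ v) = u H.~? v
  adj? (inj₁ _) (inj₂ _) = yes tt
  adj? (inj₂ _) (inj₁ _) = yes tt

  adj-sym : ∀ x y → adj x y → adj y x
  adj-sym (inj₁ _) (inj₁ _) = G.~-sym
  adj-sym (inj₂ _) (inj₂ _) = H.~-sym
  adj-sym (inj₁ _) (inj₂ _) _ = tt
  adj-sym (inj₂ _) (inj₁ _) _ = tt

  adj-irrefl : ∀ x → ¬ adj x x
  adj-irrefl (inj₁ _) = G.~-irrefl
  adj-irrefl (inj₂ _) = H.~-irrefl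

-- Wheel s is the wheel W₂ₛ of order 2s + 1.  The vertex i : Fin (2s + 1) is
-- v_j with j = i + 1.  The parameter is s rather than 2s because a rim of
-- length 1 would make the closing edge a loop.
Wheel : ℕ → Graph
Wheel s = record
  { V = Fin (suc (2 * s))
  ; order = suc (2 * s)
  ; enum = ↔-refl
  ; _~_ = λ u v → Arc (index u) (index v) ⊎ Arc (index v) (index u)
  ; _~?_ = λ u v → arc? (index u) (index v) ⊎-dec arc? (index v) (index u)
  ; ~-sym = swap
  ; ~-irrefl = λ where
      (inj₁ a) → noLoop a
      (inj₂ a) → noLoop a
  }
  where
  index : Fin (suc (2 * s)) → ℕ
  index i = suc (toℕ i)

  Arc : Rel ℕ 0ℓ
  Arc j k = (j ≡ 1 × k ≡ 2 * s)
          ⊎ (j < 2 * s × k ≡ suc j)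
          ⊎ (j ≤ 2 * s × k ≡ suc (2 * s))

  arc? : Decidable Arc
  arc? j k = ((j ≟ 1) ×-dec (k ≟ 2 * s))
       ⊎-dec ((j <? 2 * s) ×-dec (k ≟ suc j))
       ⊎-dec ((j ≤? 2 * s) ×-dec (k ≟ suc (2 * s)))

  1≢2* : ∀ t → 1 ≢ 2 * t
  1≢2* (suc t) 1≡ with trans (suc-injective 1≡) (+-suc t (t + 0))
  ... | ()

  noLoop : ∀ {j} → ¬ Arc j j
  noLoop (inj₁ (refl , 1≡2s))          = 1≢2* s 1≡2s
  noLoop (inj₂ (inj₁ (_ , j≡1+j)))     = 1+n≢n (sym j≡1+j)
  noLoop (inj₂ (inj₂ (j≤2s , refl)))   = <-irrefl refl j≤2s

{-# OPTIONS --safe #-}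

module Submission where

-- Lower bound: a copy of K₂ together with a triangle of the wheel is a K₅, and
-- adjacent vertices have different colours.
--
-- Upper bound: write aᵢbᵢ for the copies of K₂, h for the hub, and xₖ , yₖ
-- (k < s) for the rim vertices v₂ₖ₊₁ , v₂ₖ₊₂.  The four edges between aᵢbᵢ and
-- xₖyₖ are labelled by p , N − p (at aᵢ) and N − q , q (at bᵢ), so rows have
-- constant sum and only q − p enters the column sums of xₖ (negatively) and yₖ
-- (positively).  It is 2k + 1 for i = 0 and constant for i > 0.  The labels of the
-- rim vertices, rim edges and spokes are arithmetic progressions of step ±2
-- chosen so that the dependence on k and on its cyclic neighbour cancels
-- separately, whence all xₖ have one colour ξ and all yₖ one colour η.  Likewise
-- the aᵢ have one colour α and the bᵢ one colour β = α + r + 1.  Putting the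
-- blocks at the bottom makes the colour of h the largest; finally ξ < η, and
-- β < ξ if r ≥ s, while η < α if r < s.

open import Defs
open import Data.Fin as Fin using (Fin; zero; suc; toℕ; opposite; fromℕ; inject₁; combine; _↑ˡ_; _↑ʳ_)
open import Data.Fin.Patterns using (0F; 1F)
open import Data.Fin.Permutation using (↔⇒≡)
import Data.Fin.Properties as Finₚ
open import Data.Fin.Relation.Unary.Top using (view; ‵fromℕ; ‵inject₁; view-fromℕ; view-inject₁)
open import Data.List using (List; []; _∷_; length; lookup; filter; tabulate; allFin; cartesianProduct)
open import Data.List.Membership.Propositional using (_∈_)
open import Data.List.Membership.Propositional.Properties
  using (∈-lookup; ∈-filter⁺; ∈-filter⁻; ∈-allFin; ∈-cartesianProduct⁺; ∈-deduplicate⁺; ∈-deduplicate⁻; ∈-tabulate⁺; ∈-tabulate⁻)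
open import Data.List.Properties using (length-map)
open import Data.List.Relation.Binary.Subset.Propositional using (_⊆_)
open import Data.List.Relation.Unary.All as All using (All)
import Data.List.Relation.Unary.All.Properties as Allₚ
open import Data.List.Relation.Unary.AllPairs as AllPairs using (AllPairs)
import Data.List.Relation.Unary.AllPairs.Properties as AllPairsₚ
open import Data.List.Relation.Unary.Any as Any using (here; there)
open import Data.List.Relation.Unary.Any.Properties using (lookup-index)
open import Data.List.Relation.Unary.Unique.DecPropositional.Properties using (deduplicate-!)
open import Data.List.Relation.Unary.Unique.Propositional using (Unique)
open import Data.List.Relation.Unary.Unique.Propositional.Properties using (allFin⁺; cartesianProduct⁺; filter⁺)
open import Data.Nat as ℕ using (ℕ; zero; suc; _+_; _*_; _≤_; _<_; _≥_; _≟_)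
import Data.Nat.Properties as ℕₚ
open import Data.Nat.Properties using (+-0-commutativeMonoid; +-commutativeSemigroup)
open import Data.Nat.Tactic.RingSolver using (solve-∀; solve)
open import Algebra.Properties.CommutativeMonoid.Sum +-0-commutativeMonoid using (sum; sum-cong-≗; ∑-distrib-+)
open import Algebra.Properties.CommutativeSemigroup +-commutativeSemigroup using () renaming (interchange to +-interchange)
open import Data.Product using (_×_; _,_; ∃-syntax; proj₁; proj₂)
open import Data.Product.Function.NonDependent.Propositional using (_×-↔_)
open import Data.Sum using (_⊎_; inj₁; inj₂; [_,_]; swap)
open import Data.Sum.Function.Propositional using (_⊎-↔_)
open import Data.Sum.Properties using (inj₂-injective)
open import Data.Sum.Relation.Binary.Pointwise using (_⊎ₛ_; inj₁; inj₂)
open import Function using (_∘_)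
open import Function.Bundles using (_↔_; Injection; Inverse; mk↔ₛ′)
open import Function.Properties.Inverse using (↔-refl; ↔-sym; ↔-trans; Inverse⇒Injection)
open import Relation.Binary.Bundles using (Setoid)
open import Relation.Binary.Definitions using (tri<; tri≈; tri>)
open import Relation.Binary.PropositionalEquality hiding ([_])
open import Relation.Nullary using (¬_; Dec; yes; no; contradiction)
open import Relation.Nullary.Decidable using (_×-dec_)

-- Injectivity, and lengths of lists without repetition.

↔-injective : ∀ {A B : Set} (e : A ↔ B) {x y} → Inverse.to e x ≡ Inverse.to e y → x ≡ y
↔-injective e = Injection.injective (Inverse⇒Injection e)

module _ {A : Set} where

  lookup-injective : ∀ {xs : List A} → Unique xs → ∀ {i j} → lookup xs i ≡ lookup xs j → i ≡ j
  lookup-injective (_ AllPairs.∷ _)  {zero}  {zero}  _  = refl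
  lookup-injective (x∉ AllPairs.∷ _) {zero}  {suc j} eq = contradiction eq (All.lookup x∉ (∈-lookup j))
  lookup-injective (x∉ AllPairs.∷ _) {suc i} {zero}  eq = contradiction (sym eq) (All.lookup x∉ (∈-lookup i))
  lookup-injective (_ AllPairs.∷ xs!) {suc i} {suc j} eq = cong suc (lookup-injective xs! eq)

  -- Each index of `xs` is sent to an index in `ys` holding the same element. Looking that element
  -- up again recovers it, so the map is injective.
  length-mono-⊆ : ∀ {xs ys : List A} → Unique xs → xs ⊆ ys → length xs ≤ length ys
  length-mono-⊆ {xs} {ys} xs! xs⊆ys = Finₚ.injective⇒≤ {f = position} position-injective
    where
    position : Fin (length xs) → Fin (length ys)
    position i = Any.index (xs⊆ys (∈-lookup i))

    position-injective : ∀ {i j} → position i ≡ position j → i ≡ j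
    position-injective {i} {j} eq = lookup-injective xs! (begin
      lookup xs i            ≡⟨ lookup-index (xs⊆ys (∈-lookup i)) ⟩
      lookup ys (position i) ≡⟨ cong (lookup ys) eq ⟩
      lookup ys (position j) ≡⟨ lookup-index (xs⊆ys (∈-lookup j)) ⟨
      lookup xs j            ∎)
      where open ≡-Reasoning

-- Labelings from an indexing of the edges

-- One oriented representative for each unordered edge. A labeling can then be given on `I`, free of
-- orientations and adjacency proofs.
record EdgeIndexing (G : Graph) (I : Set) : Set where
  open Graph G
  field
    edge       : I → Edge
    injective  : ∀ {a b} → edge a ≈ᴱ edge b → a ≡ b
    surjective : ∀ e → ∃[ a ] edge a ≈ᴱ e

  open Edge

  ≈ᴱ-sym : ∀ d e → d ≈ᴱ e → e ≈ᴱ d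
  ≈ᴱ-sym d e = Setoid.sym edgeSetoid {d} {e}

  ≈ᴱ-trans : ∀ c d e → c ≈ᴱ d → d ≈ᴱ e → c ≈ᴱ e
  ≈ᴱ-trans c d e = Setoid.trans edgeSetoid {c} {d} {e}

  code : Edge → I
  code e = proj₁ (surjective e)

  edge-code : ∀ e → edge (code e) ≈ᴱ e
  edge-code e = proj₂ (surjective e)

  code-unique : ∀ a e → edge a ≈ᴱ e → code e ≡ a
  code-unique a e eq =
    injective (≈ᴱ-trans (edge (code e)) e (edge a) (edge-code e) (≈ᴱ-sym (edge a) e eq))

  code-cong : ∀ d e → d ≈ᴱ e → code d ≡ code e
  code-cong d e eq =
    code-unique (code e) d (≈ᴱ-trans (edge (code e)) e d (edge-code e) (≈ᴱ-sym d e eq))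

  code-injective : ∀ d e → code d ≡ code e → d ≈ᴱ e
  code-injective d e eq = ≈ᴱ-trans d (edge (code d)) e (≈ᴱ-sym (edge (code d)) d (edge-code d))
    (subst (λ a → edge a ≈ᴱ e) (sym eq) (edge-code e))

  private
    Oriented : Fin order × Fin order → Set
    Oriented (i , j) = (i Fin.< j) × (vertex i ~ vertex j)

    oriented? : ∀ p → Dec (Oriented p)
    oriented? (i , j) = (i Fin.<? j) ×-dec (vertex i ~? vertex j)

    pairs : List (Fin order × Fin order)
    pairs = filter oriented? (cartesianProduct (allFin order) (allFin order))

    pairs! : Unique pairs
    pairs! = filter⁺ oriented? (cartesianProduct⁺ (allFin⁺ order) (allFin⁺ order))

    codePair : ∀ {p} → Oriented p → I
    codePair (_ , u~v) = code (mkEdge u~v)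

    -- Equal codes mean the same edge in the same or in the opposite direction, and two increasing
    -- pairs cannot be opposite.
    codePair-injective : ∀ {p q} (op : Oriented p) (oq : Oriented q) → codePair op ≡ codePair oq → p ≡ q
    codePair-injective (i<j , u~v) (k<l , x~y) eq
      with code-injective (mkEdge u~v) (mkEdge x~y) eq
    ... | inj₁ (i≡k , j≡l) = cong₂ _,_ (↔-injective enum i≡k) (↔-injective enum j≡l)
    ... | inj₂ (i≡l , j≡k) with ↔-injective enum i≡l | ↔-injective enum j≡k
    ...   | refl | refl = contradiction i<j (Finₚ.<-asym k<l)

    -- The representative is turned around when its ends are in decreasing order; equal ends would
    -- make a loop.
    pairOf : ∀ a → ∃[ p ] ∃[ op ] codePair {p} op ≡ a
    pairOf a = go (Finₚ.<-cmp i j)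
      where
      i j : Fin order
      i = Inverse.from enum (end₁ (edge a))
      j = Inverse.from enum (end₂ (edge a))
      vi : vertex i ≡ end₁ (edge a)
      vi = Inverse.strictlyInverseˡ enum _
      vj : vertex j ≡ end₂ (edge a)
      vj = Inverse.strictlyInverseˡ enum _
      i~j : vertex i ~ vertex j
      i~j = subst₂ _~_ (sym vi) (sym vj) (adjacent (edge a))
      go : _ → ∃[ p ] ∃[ op ] codePair {p} op ≡ a
      go (tri< i<j _ _) = (i , j) , (i<j , i~j) , code-unique a _ (inj₁ (sym vi , sym vj))
      go (tri> _ _ j<i) = (j , i) , (j<i , ~-sym i~j) , code-unique a _ (inj₂ (sym vi , sym vj))
      go (tri≈ _ i≡j _) = contradiction (subst (λ k → vertex i ~ vertex k) (sym i≡j) i~j) ~-irrefl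

  -- `size` counts adjacent pairs in increasing order, and every edge has exactly one such
  -- orientation.
  size↔ : Fin size ↔ I
  size↔ = mk↔ₛ′ to from to∘from (λ i → to-injective (to∘from (to i)))
    where
    ∈pairs⇒oriented : ∀ {p} → p ∈ pairs → Oriented p
    ∈pairs⇒oriented p∈ = proj₂ (∈-filter⁻ oriented? {xs = cartesianProduct (allFin order) (allFin order)} p∈)

    to : Fin size → I
    to i = codePair (∈pairs⇒oriented (∈-lookup i))

    to-injective : ∀ {i j} → to i ≡ to j → i ≡ j
    to-injective {i} {j} eq = lookup-injective pairs!
      (codePair-injective (∈pairs⇒oriented (∈-lookup i)) (∈pairs⇒oriented (∈-lookup j)) eq)

    ∈pairs : ∀ {p} → Oriented p → p ∈ pairs
    ∈pairs op = ∈-filter⁺ oriented? (∈-cartesianProduct⁺ (∈-allFin _) (∈-allFin _)) op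

    from : I → Fin size
    from a = Any.index (∈pairs (proj₁ (proj₂ (pairOf a))))

    to∘from : ∀ a → to (from a) ≡ a
    to∘from a with pairOf a
    -- The pair found in the list may carry another adjacency proof; `code` depends only on the two
    -- ends.
    ... | p , op , refl = code-cong (mkEdge _) (mkEdge _) (inj₁ (ends proj₁ , ends proj₂))
      where
      ends : (π : Fin order × Fin order → Fin order) → vertex (π (lookup pairs (Any.index (∈pairs op)))) ≡ vertex (π p)
      ends π = cong (vertex ∘ π) (sym (lookup-index (∈pairs op)))

  module _ {T} (position : (V ⊎ I) ↔ Fin T) where

    private
      -- Both sides count vertices and edges together, so `size` is never evaluated.
      total : T ≡ order + size
      total = ↔⇒≡ (↔-trans (↔-sym position) (↔-sym (↔-trans Finₚ.+↔⊎ (enum ⊎-↔ size↔))))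

      codeᵀ : V ⊎ Edge → V ⊎ I
      codeᵀ (inj₁ v) = inj₁ v
      codeᵀ (inj₂ e) = inj₂ (code e)

      cast-injective : ∀ {i j : Fin T} → Fin.cast total i ≡ Fin.cast total j → i ≡ j
      cast-injective {i} {j} eq = Finₚ.toℕ-injective
        (trans (sym (Finₚ.toℕ-cast total i)) (trans (cong toℕ eq) (Finₚ.toℕ-cast total j)))

      _≋_ : V ⊎ Edge → V ⊎ Edge → Set
      _≋_ = Setoid._≈_ (setoid V ⊎ₛ edgeSetoid)

      to : V ⊎ Edge → Fin (order + size)
      to x = Fin.cast total (Inverse.to position (codeᵀ x))

      to-cong : ∀ {x y} → x ≋ y → to x ≡ to y
      to-cong (inj₁ refl) = refl
      to-cong (inj₂ {d} {e} d≈e) =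
        cong (λ a → Fin.cast total (Inverse.to position (inj₂ a))) (code-cong d e d≈e)

      codeᵀ-injective : ∀ x y → codeᵀ x ≡ codeᵀ y → x ≋ y
      codeᵀ-injective (inj₁ _) (inj₁ _) refl = inj₁ refl
      codeᵀ-injective (inj₂ d) (inj₂ e) eq   = inj₂ (code-injective d e (inj₂-injective eq))

      decodeᵀ : ∀ x → ∃[ y ] codeᵀ y ≡ x
      decodeᵀ (inj₁ v) = inj₁ v , refl
      decodeᵀ (inj₂ a) = inj₂ (edge a) , cong inj₂ (code-unique a (edge a) (inj₁ (refl , refl)))

      to-surjective : ∀ k → ∃[ x ] ∀ {z} → z ≋ x → to z ≡ k
      to-surjective k = preimage (decodeᵀ (Inverse.from position k⁻))
        where
        open ≡-Reasoning
        k⁻ : Fin T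
        k⁻ = Fin.cast (sym total) k
        preimage : ∃[ x ] codeᵀ x ≡ Inverse.from position k⁻ → ∃[ x ] ∀ {z} → z ≋ x → to z ≡ k
        preimage (x , eq) = x , λ {z} z≋x → begin
          to z
            ≡⟨ to-cong z≋x ⟩
          Fin.cast total (Inverse.to position (codeᵀ x))
            ≡⟨ cong (λ y → Fin.cast total (Inverse.to position y)) eq ⟩
          Fin.cast total (Inverse.to position (Inverse.from position k⁻))
            ≡⟨ cong (Fin.cast total) (Inverse.strictlyInverseˡ position k⁻) ⟩
          Fin.cast total k⁻
            ≡⟨ Finₚ.cast-involutive total (sym total) k ⟩
          k ∎

    labeling : TotalLabeling G
    labeling = record
      { to        = to
      ; cong      = to-cong
      ; bijective = (λ {x} {y} eq → codeᵀ-injective x y (↔-injective position (cast-injective eq))) , to-surjective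
      }

    positionⁿ : V ⊎ I → ℕ
    positionⁿ = toℕ ∘ Inverse.to position

    label-vertex : ∀ v → label G labeling (inj₁ v) ≡ suc (positionⁿ (inj₁ v))
    label-vertex v = cong suc (Finₚ.toℕ-cast total _)

    label-edge : ∀ a e → edge a ≈ᴱ e → label G labeling (inj₂ e) ≡ suc (positionⁿ (inj₂ a))
    label-edge a e eq = cong suc (trans (Finₚ.toℕ-cast total _)
      (cong (λ b → positionⁿ (inj₂ b)) (code-unique a e eq)))

-- Bounds on the number of colours.

module _ (G : Graph) (f : TotalLabeling G) where
  open Graph G

  private
    colours : List ℕ
    colours = tabulate (f⁺tn G f ∘ vertex)

    f⁺tn∈colours : ∀ v → f⁺tn G f v ∈ colours
    f⁺tn∈colours v = subst (λ x → f⁺tn G f x ∈ colours) (Inverse.strictlyInverseˡ enum v) (∈-tabulate⁺ _)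

    ∈colours⁻ : ∀ {c} → c ∈ colours → ∃[ v ] c ≡ f⁺tn G f v
    ∈colours⁻ c∈ with ∈-tabulate⁻ c∈
    ... | i , eq = vertex i , eq

  length≤ctn : ∀ {cs} → Unique cs → All (λ c → ∃[ v ] c ≡ f⁺tn G f v) cs → length cs ≤ ctn G f
  length≤ctn cs! attained = length-mono-⊆ cs! λ c∈cs →
    ∈-deduplicate⁺ _≟_ (lemma (All.lookup attained c∈cs))
    where
    lemma : ∀ {c} → ∃[ v ] c ≡ f⁺tn G f v → c ∈ colours
    lemma (v , refl) = f⁺tn∈colours v

  ctn≤length : ∀ {cs} → (∀ v → f⁺tn G f v ∈ cs) → ctn G f ≤ length cs
  ctn≤length all∈ = length-mono-⊆ (deduplicate-! _≟_ colours) λ c∈ →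
    let v , eq = ∈colours⁻ (∈-deduplicate⁻ _≟_ colours c∈) in subst (_∈ _) (sym eq) (all∈ v)

  -- The vertices of a clique are pairwise adjacent, so their colours form a list without
  -- repetition.
  clique≤ctn : IsLocalTotalNeighborhoodAntimagic G f → ∀ {vs} → AllPairs _~_ vs → length vs ≤ ctn G f
  clique≤ctn antimagic {vs} clique = subst (_≤ ctn G f) (length-map (f⁺tn G f) vs)
    (length≤ctn (AllPairsₚ.map⁺ (AllPairs.map antimagic clique)) (Allₚ.map⁺ (All.universal (λ v → v , refl) vs)))

-- The clique bounds every labeling from below. The given labeling uses only colours from a list of
-- the same length, so it meets that bound.
χltna-by-clique : ∀ {G} → Graph.NoIsolatedVertices G → ∀ {vs} → AllPairs (Graph._~_ G) vs →
  ∀ f → IsLocalTotalNeighborhoodAntimagic G f → ∀ {cs} → (∀ v → f⁺tn G f v ∈ cs) → length cs ≡ length vs →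
  χltna G is length vs
χltna-by-clique {G} noIsolated clique f antimagic all∈ cs≡vs = record
  { noIsolatedVertices = noIsolated
  ; attained           = f , antimagic ,
    ℕₚ.≤-antisym (ℕₚ.≤-trans (ctn≤length G f all∈) (ℕₚ.≤-reflexive cs≡vs)) (clique≤ctn G f antimagic clique)
  ; minimal            = λ g g-antimagic → clique≤ctn G g g-antimagic clique
  }

private variable
  m n : ℕ
  S : Set

-- Finite sums

sum-const : ∀ {f : Fin n → ℕ} c → (∀ i → f i ≡ c) → sum f ≡ n * c
sum-const {zero}  c f≡c = refl
sum-const {suc n} c f≡c = cong₂ _+_ (f≡c zero) (sum-const c (f≡c ∘ suc))

sum-zero : ∀ {f : Fin n → ℕ} → (∀ i → f i ≡ 0) → sum f ≡ 0
sum-zero {n} f≡0 = trans (sum-const 0 f≡0) (ℕₚ.*-zeroʳ n)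

sum-≥ : ∀ {f : Fin n → ℕ} c → (∀ i → c ≤ f i) → n * c ≤ sum f
sum-≥ {zero}  c c≤f = ℕₚ.≤-refl
sum-≥ {suc n} c c≤f = ℕₚ.+-mono-≤ (c≤f zero) (sum-≥ c (c≤f ∘ suc))

sum-≤ : ∀ {f : Fin n → ℕ} c → (∀ i → f i ≤ c) → sum f ≤ n * c
sum-≤ {zero}  c f≤c = ℕₚ.≤-refl
sum-≤ {suc n} c f≤c = ℕₚ.+-mono-≤ (f≤c zero) (sum-≤ c (f≤c ∘ suc))

sum-only : ∀ {f : Fin n → ℕ} i → (∀ j → j ≢ i → f j ≡ 0) → sum f ≡ f i
sum-only {f = f} zero f≡0 = trans (cong (f zero +_) (sum-zero (λ j → f≡0 (suc j) λ ()))) (ℕₚ.+-identityʳ _)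
sum-only (suc i) f≡0 =
  cong₂ _+_ (f≡0 zero λ ()) (sum-only i (λ j j≢i → f≡0 (suc j) (j≢i ∘ Finₚ.suc-injective)))

-- Meant for a rim vertex, whose two rim neighbours lie in two different columns.
sum-only₂ : ∀ {f : Fin n → ℕ} i j → i ≢ j → (∀ k → k ≢ i → k ≢ j → f k ≡ 0) → sum f ≡ f i + f j
sum-only₂ zero zero i≢j f≡0 = contradiction refl i≢j
sum-only₂ {f = f} zero (suc j) i≢j f≡0 =
  cong (f zero +_) (sum-only j (λ k k≢j → f≡0 (suc k) (λ ()) (k≢j ∘ Finₚ.suc-injective)))
sum-only₂ {f = f} (suc i) zero i≢j f≡0 =
  trans (cong (f zero +_) (sum-only i (λ k k≢i → f≡0 (suc k) (k≢i ∘ Finₚ.suc-injective) λ ()))) (ℕₚ.+-comm (f zero) _)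
sum-only₂ (suc i) (suc j) i≢j f≡0 = cong₂ _+_ (f≡0 zero (λ ()) λ ())
  (sum-only₂ i j (i≢j ∘ cong suc) λ k k≢i k≢j → f≡0 (suc k) (k≢i ∘ Finₚ.suc-injective) (k≢j ∘ Finₚ.suc-injective))

sum-+ : ∀ m (f : Fin (m + n) → ℕ) → sum f ≡ sum (λ i → f (i ↑ˡ n)) + sum (λ j → f (m ↑ʳ j))
sum-+ zero    f = refl
sum-+ (suc m) f = trans (cong (f zero +_) (sum-+ m (f ∘ suc))) (sym (ℕₚ.+-assoc (f zero) _ _))

sum-* : ∀ m (f : Fin (m * n) → ℕ) → sum f ≡ sum (λ i → sum (λ j → f (combine {m} {n} i j)))
sum-* zero    f = refl
sum-* {n} (suc m) f = trans (sum-+ n f) (cong (sum (λ j → f (j ↑ˡ (m * n))) +_) (sum-* m (f ∘ (n ↑ʳ_))))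

sum-cast : ∀ .(eq : m ≡ n) (f : Fin n → ℕ) → sum f ≡ sum (f ∘ Fin.cast eq)
sum-cast {zero}  {zero}  eq f = refl
sum-cast {suc m} {suc n} eq f = cong (f zero +_) (sum-cast (ℕₚ.suc-injective eq) (f ∘ suc))

-- The cyclic successor

next : Fin n → Fin n
next {suc n} k with view k
... | ‵fromℕ     = zero
... | ‵inject₁ j = suc j

next-fromℕ : ∀ n → next (fromℕ n) ≡ zero
next-fromℕ n rewrite view-fromℕ n = refl

next-inject₁ : ∀ (k : Fin n) → next (inject₁ k) ≡ suc k
next-inject₁ k rewrite view-inject₁ k = refl

prev : Fin n → Fin n
prev {suc n} zero    = fromℕ n
prev         (suc k) = inject₁ k

next-prev : ∀ (k : Fin n) → next (prev k) ≡ k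
next-prev {suc n} zero    = next-fromℕ n
next-prev         (suc k) = next-inject₁ k

prev-next : ∀ (k : Fin n) → prev (next k) ≡ k
prev-next {suc n} k with view k
... | ‵fromℕ     = refl
... | ‵inject₁ _ = refl

next-injective : ∀ {j k : Fin n} → next j ≡ next k → j ≡ k
next-injective {j = j} {k} eq = trans (sym (prev-next j)) (trans (cong prev eq) (prev-next k))

-- Keeps the two rim edges at a vertex distinct, which takes at least two columns.
next≢ : ∀ (k : Fin (suc (suc n))) → next k ≢ k
next≢ k with view k
... | ‵fromℕ     = λ ()
... | ‵inject₁ j = λ eq → ℕₚ.1+n≢n (trans (cong toℕ eq) (Finₚ.toℕ-inject₁ j))

toℕ-next : ∀ (k : Fin n) → (suc (toℕ k) ≡ n × toℕ (next k) ≡ 0) ⊎ toℕ (next k) ≡ suc (toℕ k)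
toℕ-next {suc n} k with view k
... | ‵fromℕ     = inj₁ (cong suc (Finₚ.toℕ-fromℕ n) , refl)
... | ‵inject₁ j = inj₂ (cong suc (sym (Finₚ.toℕ-inject₁ j)))

-- The source of the constant colours: labels indexed by `k` are balanced against labels indexed by
-- its opposite.
1+toℕ+opposite : ∀ (k : Fin n) → suc (toℕ k + toℕ (opposite k)) ≡ n
1+toℕ+opposite {suc n} k = cong suc
  (trans (cong (toℕ k +_) (Finₚ.opposite-prop k)) (ℕₚ.m+[n∸m]≡n (Finₚ.toℕ≤pred[n] k)))

-- Numberings of finite types

infixr 5 _⊕_
infixr 6 _⊗_

-- Codes for finite sets together with an order: sums list the left part first, products are
-- lexicographic. The order of all labels is one such code.
data Shape : Set where
  fin     : ℕ → Shape
  _⊕_ _⊗_ : Shape → Shape → Shape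
  -- flip c is c numbered backwards.
  flip    : Shape → Shape

El : Shape → Set
El (fin n)  = Fin n
El (c ⊕ d)  = El c ⊎ El d
El (c ⊗ d)  = El c × El d
El (flip c) = El c

∣_∣ : Shape → ℕ
∣ fin n ∣  = n
∣ c ⊕ d ∣  = ∣ c ∣ + ∣ d ∣
∣ c ⊗ d ∣  = ∣ c ∣ * ∣ d ∣
∣ flip c ∣ = ∣ c ∣

opposite↔ : Fin n ↔ Fin n
opposite↔ = mk↔ₛ′ opposite opposite Finₚ.opposite-involutive Finₚ.opposite-involutive

index : ∀ c → El c ↔ Fin ∣ c ∣
index (fin n)  = ↔-refl
index (c ⊕ d)  = ↔-trans (index c ⊎-↔ index d) (↔-sym Finₚ.+↔⊎)
index (c ⊗ d)  = ↔-trans (index c ×-↔ index d) (↔-sym Finₚ.*↔×)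
index (flip c) = ↔-trans (index c) opposite↔

toℕ⟨_⟩ : S ↔ Fin n → S → ℕ
toℕ⟨ p ⟩ = toℕ ∘ Inverse.to p

-- The number of an element when counting starts at `o`, written so that it computes to arithmetic
-- in the components.
offset : ∀ c → ℕ → El c → ℕ
offset (fin n)  o i        = o + toℕ i
offset (c ⊕ d)  o (inj₁ x) = offset c o x
offset (c ⊕ d)  o (inj₂ y) = offset d (o + ∣ c ∣) y
offset (c ⊗ d)  o (x , y)  = o + (∣ d ∣ * offset c 0 x + offset d 0 y)
offset (flip c) o x        = o + toℕ (opposite (Inverse.to (index c) x))

offset≡ : ∀ c o x → o + toℕ⟨ index c ⟩ x ≡ offset c o x
offset≡ (fin n)  o i        = refl
offset≡ (c ⊕ d)  o (inj₁ x) = trans (cong (o +_) (Finₚ.toℕ-↑ˡ (Inverse.to (index c) x) _)) (offset≡ c o x)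
offset≡ (c ⊕ d)  o (inj₂ y) = trans (cong (o +_) (Finₚ.toℕ-↑ʳ ∣ c ∣ (Inverse.to (index d) y)))
  (trans (sym (ℕₚ.+-assoc o ∣ c ∣ _)) (offset≡ d (o + ∣ c ∣) y))
offset≡ (c ⊗ d)  o (x , y)  = cong (o +_) (trans (Finₚ.toℕ-combine (Inverse.to (index c) x) (Inverse.to (index d) y))
  (cong₂ (λ a b → ∣ d ∣ * a + b) (offset≡ c 0 x) (offset≡ d 0 y)))
offset≡ (flip c) o x        = refl

cast↔ : m ≡ n → Fin m ↔ Fin n
cast↔ eq = mk↔ₛ′ (Fin.cast eq) (Fin.cast (sym eq)) (Finₚ.cast-involutive eq (sym eq)) (Finₚ.cast-involutive (sym eq) eq)

-- With k mirrored in the first half of row 0, the difference q − p of the block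
-- in column k has slope 2 in k.
mirror : Fin m → Fin 2 → Fin n → Fin n
mirror 0F 0F = opposite
mirror _  _  = λ k → k

mirror-involutive : ∀ (i : Fin m) t (k : Fin n) → mirror i t (mirror i t k) ≡ k
mirror-involutive 0F      0F k = Finₚ.opposite-involutive k
mirror-involutive 0F      1F k = refl
mirror-involutive (suc _) t  k = refl

-- The graph rK₂ ∨ W₂ₛ

-- rim k 0F is v₂ₖ₊₁ and rim k 1F is v₂ₖ₊₂.
pattern apex i t = inj₁ (i , t)
pattern rim k b  = inj₂ (inj₁ (k , b))
pattern hub      = inj₂ (inj₂ 0F)

module Construction (r s : ℕ) where

  G : Graph
  G = (r copiesOf K 2) ∨ Wheel s

  open Graph G

  -- Names for the vertices that show the pairs aᵢbᵢ and xₖyₖ; in `V` the wheel is a single `Fin`.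
  W : Set
  W = (Fin r × Fin 2) ⊎ ((Fin s × Fin 2) ⊎ Fin 1)

  wheelOrder : s * 2 + 1 ≡ suc (2 * s)
  wheelOrder = trans (ℕₚ.+-comm (s * 2) 1) (cong suc (ℕₚ.*-comm s 2))

  wheelShape : Shape
  wheelShape = (fin s ⊗ fin 2) ⊕ fin 1

  wheel↔ : ((Fin s × Fin 2) ⊎ Fin 1) ↔ Fin (suc (2 * s))
  wheel↔ = ↔-trans (index wheelShape) (cast↔ wheelOrder)

  W↔V : W ↔ V
  W↔V = ↔-refl ⊎-↔ wheel↔

  ⟦_⟧ : W → V
  ⟦_⟧ = Inverse.to W↔V

  -- The two members of a pair stay together, since it is their labels that combine to constants.
  sum-vertices : ∀ (g : V → ℕ) → sum (g ∘ vertex) ≡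
    sum (λ i → g ⟦ apex i 0F ⟧ + g ⟦ apex i 1F ⟧) + (sum (λ k → g ⟦ rim k 0F ⟧ + g ⟦ rim k 1F ⟧) + g ⟦ hub ⟧)
  sum-vertices g = begin
    sum (g ∘ vertex)
      ≡⟨ sum-+ (r * 2) (g ∘ vertex) ⟩
    sum (λ a → g (vertex (a ↑ˡ suc (2 * s)))) + sum onWheel
      ≡⟨ cong₂ _+_ (sum-pairs r _ _ λ i t → cong g (vertex-apex i t))
                   (trans (sum-cast wheelOrder onWheel) (sum-+ (s * 2) (onWheel ∘ Fin.cast wheelOrder))) ⟩
    sum (λ i → g ⟦ apex i 0F ⟧ + g ⟦ apex i 1F ⟧) +
    (sum (λ c → onWheel (Fin.cast wheelOrder (c ↑ˡ 1))) + (onWheel (Fin.cast wheelOrder (s * 2 ↑ʳ 0F)) + 0))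
      ≡⟨ cong (sum (λ i → g ⟦ apex i 0F ⟧ + g ⟦ apex i 1F ⟧) +_) (cong₂ _+_
           (sum-pairs s _ _ λ k b → cong g (vertex-wheel (inj₁ (k , b))))
           (trans (ℕₚ.+-identityʳ _) (cong g (vertex-wheel (inj₂ 0F))))) ⟩
    sum (λ i → g ⟦ apex i 0F ⟧ + g ⟦ apex i 1F ⟧) + (sum (λ k → g ⟦ rim k 0F ⟧ + g ⟦ rim k 1F ⟧) + g ⟦ hub ⟧) ∎
    where
    open ≡-Reasoning
    onWheel : Fin (suc (2 * s)) → ℕ
    onWheel v = g (vertex (r * 2 ↑ʳ v))
    vertex-apex : ∀ i t → vertex (combine i t ↑ˡ suc (2 * s)) ≡ ⟦ apex i t ⟧
    vertex-apex i t rewrite Finₚ.splitAt-↑ˡ (r * 2) (combine i t) (suc (2 * s)) | Finₚ.remQuot-combine i t = refl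
    vertex-wheel : ∀ v → vertex (r * 2 ↑ʳ Inverse.to wheel↔ v) ≡ ⟦ inj₂ v ⟧
    vertex-wheel v rewrite Finₚ.splitAt-↑ʳ (r * 2) (suc (2 * s)) (Inverse.to wheel↔ v) = refl
    sum-pairs : ∀ m (f : Fin (m * 2) → ℕ) (h : Fin m → Fin 2 → ℕ) → (∀ i t → f (combine {m} {2} i t) ≡ h i t) →
                sum f ≡ sum (λ i → h i 0F + h i 1F)
    sum-pairs m f h f≡h = trans (sum-* m f) (sum-cong-≗ λ i →
      cong₂ _+_ (f≡h i 0F) (trans (ℕₚ.+-identityʳ _) (f≡h i 1F)))

  -- Names for the edges by type. The `rung` and `arc` edges alternate around the rim: a rung lies
  -- inside a column, an arc leads from yₖ to the x of the next column.
  data Link : Set where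
    link  : Fin r → Link
    cross : Fin r → Fin 2 → Fin s → Fin 2 → Link
    axle  : Fin r → Fin 2 → Link
    rung  : Fin s → Link
    arc   : Fin s → Link
    spoke : Fin s → Fin 2 → Link

  ends : Link → W × W
  ends (link i)        = apex i 0F , apex i 1F
  ends (cross i t k b) = apex i t , rim k b
  ends (axle i t)      = apex i t , hub
  ends (rung k)        = rim k 0F , rim k 1F
  ends (arc k)         = rim (next k) 0F , rim k 1F
  ends (spoke k b)     = rim k b , hub

  Joins : Link → W → W → Set
  Joins e u v = ends e ≡ (u , v) ⊎ ends e ≡ (v , u)

  -- Positions in the wheel, and adjacency in terms of named edges.

  private
    slot : (Fin s × Fin 2) ⊎ Fin 1 → ℕ
    slot = toℕ⟨ wheel↔ ⟩

    slot-injective : ∀ {u v} → slot u ≡ slot v → u ≡ v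
    slot-injective eq = ↔-injective wheel↔ (Finₚ.toℕ-injective eq)

    slot-offset : ∀ v → slot v ≡ offset wheelShape 0 v
    slot-offset v = trans (Finₚ.toℕ-cast wheelOrder _) (offset≡ wheelShape 0 v)

    slot-hub : slot (inj₂ 0F) ≡ 2 * s
    slot-hub = trans (slot-offset (inj₂ 0F)) (trans (ℕₚ.+-identityʳ _) (ℕₚ.*-comm s 2))

    slot-X : ∀ k → slot (inj₁ (k , 0F)) ≡ 2 * toℕ k
    slot-X k = trans (slot-offset (inj₁ (k , 0F))) (ℕₚ.+-identityʳ _)

    slot-Y : ∀ k → slot (inj₁ (k , 1F)) ≡ suc (2 * toℕ k)
    slot-Y k = trans (slot-offset (inj₁ (k , 1F))) (ℕₚ.+-comm _ 1)

    suc-slot-Y : ∀ k → suc (slot (inj₁ (k , 1F))) ≡ 2 * suc (toℕ k)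
    suc-slot-Y k = trans (cong suc (slot-Y k)) (sym (ℕₚ.*-suc 2 (toℕ k)))

    slot-rim< : ∀ k b → slot (inj₁ (k , b)) < 2 * s
    slot-rim< k b = ℕₚ.≤∧≢⇒< (Finₚ.toℕ≤pred[n] (Inverse.to wheel↔ (inj₁ (k , b))))
      λ eq → contradiction (slot-injective {inj₁ (k , b)} {inj₂ 0F} (trans eq (sym slot-hub))) λ ()

    -- Repeats the relation local to `Wheel`; both unfold to the same type.
    Arc : ℕ → ℕ → Set
    Arc j k = (j ≡ 1 × k ≡ 2 * s) ⊎ (j < 2 * s × k ≡ suc j) ⊎ (j ≤ 2 * s × k ≡ suc (2 * s))

    odd≢even : ∀ a b → suc (2 * a) ≢ 2 * b
    odd≢even a b = ℕₚ.even≢odd b a ∘ sym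

  ends-adjacent : ∀ e → ⟦ proj₁ (ends e) ⟧ ~ ⟦ proj₂ (ends e) ⟧
  ends-adjacent (link i)        = refl , λ ()
  ends-adjacent (cross i t k b) = _
  ends-adjacent (axle i t)      = _
  ends-adjacent (rung k)        = inj₁ (inj₂ (inj₁
    ( subst (_≤ 2 * s) (cong suc (trans (slot-Y k) (cong suc (sym (slot-X k))))) (slot-rim< k 1F)
    , cong suc (trans (slot-Y k) (cong suc (sym (slot-X k)))))))
  ends-adjacent (arc k) with toℕ-next k
  -- In the last column the arc is the closing edge v₁v₂ₛ.
  ... | inj₁ (1+k≡s , next≡0) = inj₁ (inj₁
    ( cong suc (trans (slot-X (next k)) (cong (2 *_) next≡0))
    , trans (suc-slot-Y k) (cong (2 *_) 1+k≡s)))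
  ... | inj₂ next≡1+k = inj₂ (inj₂ (inj₁
    ( subst (_< 2 * s) slot≡ (slot-rim< (next k) 0F)
    , cong suc slot≡)))
    where
    slot≡ : slot (inj₁ (next k , 0F)) ≡ suc (slot (inj₁ (k , 1F)))
    slot≡ = trans (slot-X (next k)) (trans (cong (2 *_) next≡1+k) (sym (suc-slot-Y k)))
  ends-adjacent (spoke k b) = inj₁ (inj₂ (inj₂ (slot-rim< k b , cong suc slot-hub)))

  private
    -- One group of cases per clause of `Arc`: the closing edge, consecutive vertices, spokes.
    -- Consecutive vertices form a rung or an arc according to the parity of the smaller index.
    arc⇒joins : ∀ u v → Arc (suc (slot u)) (suc (slot v)) → ∃[ e ] Joins e (inj₂ u) (inj₂ v)
    arc⇒joins u (inj₂ 0F) (inj₁ (_ , eq)) = contradiction (trans (sym eq) (cong suc slot-hub)) (ℕₚ.1+n≢n ∘ sym)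
    -- The vertex xₖ has odd index 2k + 1, so it is not v₂ₛ.
    arc⇒joins u (inj₁ (k , 0F)) (inj₁ (_ , eq)) =
      contradiction (trans (cong suc (sym (slot-X k))) eq) (odd≢even (toℕ k) s)
    arc⇒joins u (inj₁ (k , 1F)) (inj₁ (u≡ , v≡)) with toℕ-next k
    -- If yₖ is v₂ₛ then k + 1 = s, which is no index of a column.
    ... | inj₂ next≡1+k = contradiction
      (trans next≡1+k (ℕₚ.*-cancelˡ-≡ _ _ 2 (trans (sym (suc-slot-Y k)) v≡))) (ℕₚ.<⇒≢ (Finₚ.toℕ<n (next k)))
    ... | inj₁ (_ , next≡0) with slot-injective {u} {inj₁ (next k , 0F)}
      (trans (ℕₚ.suc-injective u≡) (sym (trans (slot-X (next k)) (cong (2 *_) next≡0))))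
    ...   | refl = arc k , inj₁ refl
    arc⇒joins (inj₂ 0F) v (inj₂ (inj₁ (u< , _))) =
      contradiction (ℕₚ.<-trans (ℕₚ.n<1+n _) (subst (λ x → suc x < 2 * s) slot-hub u<)) (ℕₚ.<-irrefl refl)
    arc⇒joins (inj₁ (k , 0F)) v (inj₂ (inj₁ (_ , v≡)))
      with slot-injective {v} {inj₁ (k , 1F)}
        (trans (ℕₚ.suc-injective v≡) (trans (cong suc (slot-X k)) (sym (slot-Y k))))
    ... | refl = rung k , inj₁ refl
    arc⇒joins (inj₁ (k , 1F)) v (inj₂ (inj₁ (u< , v≡))) with toℕ-next k
    -- In the last column yₖ is v₂ₛ, which the strict bound of this clause excludes.
    ... | inj₁ (1+k≡s , _) = contradiction (trans (suc-slot-Y k) (cong (2 *_) 1+k≡s)) (ℕₚ.<⇒≢ u<)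
    ... | inj₂ next≡1+k with slot-injective {v} {inj₁ (next k , 0F)}
      (trans (ℕₚ.suc-injective v≡) (trans (suc-slot-Y k) (trans (cong (2 *_) (sym next≡1+k)) (sym (slot-X (next k))))))
    ...   | refl = arc k , inj₂ refl
    arc⇒joins (inj₂ 0F) v (inj₂ (inj₂ (u≤ , _))) =
      contradiction (subst (λ x → suc x ≤ 2 * s) slot-hub u≤) (ℕₚ.<-irrefl refl)
    arc⇒joins (inj₁ (k , b)) v (inj₂ (inj₂ (_ , v≡)))
      with slot-injective {v} {inj₂ 0F} (trans (ℕₚ.suc-injective v≡) (sym slot-hub))
    ... | refl = spoke k b , inj₁ refl

  joins⇒adjacent : ∀ e {u v} → Joins e u v → ⟦ u ⟧ ~ ⟦ v ⟧
  joins⇒adjacent e (inj₁ refl) = ends-adjacent e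
  joins⇒adjacent e {u} {v} (inj₂ refl) = ~-sym {⟦ v ⟧} {⟦ u ⟧} (ends-adjacent e)

  joins-sym : ∀ {e u v} → Joins e u v → Joins e v u
  joins-sym = swap

  adjacent⇒joins : ∀ u v → ⟦ u ⟧ ~ ⟦ v ⟧ → ∃[ e ] Joins e u v
  adjacent⇒joins (apex i 0F) (apex i 0F) (refl , t≢t) = contradiction refl t≢t
  adjacent⇒joins (apex i 0F) (apex i 1F) (refl , _)   = link i , inj₁ refl
  adjacent⇒joins (apex i 1F) (apex i 0F) (refl , _)   = link i , inj₂ refl
  adjacent⇒joins (apex i 1F) (apex i 1F) (refl , t≢t) = contradiction refl t≢t
  adjacent⇒joins (apex i t)  (rim k b)   _ = cross i t k b , inj₁ refl
  adjacent⇒joins (apex i t)  hub         _ = axle i t , inj₁ refl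
  adjacent⇒joins (rim k b)   (apex i t)  _ = cross i t k b , inj₂ refl
  adjacent⇒joins hub         (apex i t)  _ = axle i t , inj₂ refl
  adjacent⇒joins (inj₂ u)    (inj₂ v)    (inj₁ a) = arc⇒joins u v a
  adjacent⇒joins (inj₂ u)    (inj₂ v)    (inj₂ a) with arc⇒joins v u a
  ... | e , j = e , joins-sym {e} j

  private
    -- Every stored orientation goes strictly up in rank, so no stored edge is the reversal of
    -- another.
    rank : W → ℕ
    rank (apex _ t) = toℕ t
    rank (rim _ b)  = 2 + toℕ b
    rank hub        = 4

    rank-ends : ∀ e → rank (proj₁ (ends e)) < rank (proj₂ (ends e))
    rank-ends (link i)        = ℕₚ.≤-refl
    rank-ends (cross i t k b) = ℕₚ.≤-trans (Finₚ.toℕ<n t) (ℕₚ.m≤m+n 2 (toℕ b))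
    rank-ends (axle i t)      = ℕₚ.≤-trans (Finₚ.toℕ<n t) (ℕₚ.m≤m+n 2 2)
    rank-ends (rung k)        = ℕₚ.≤-refl
    rank-ends (arc k)         = ℕₚ.≤-refl
    rank-ends (spoke k b)     = ℕₚ.+-monoʳ-< 2 (Finₚ.toℕ<n b)

    rim-injective : ∀ {k l b c} → _≡_ {A = W} (rim k b) (rim l c) → k ≡ l
    rim-injective refl = refl

    unends : ∀ {u u′ v v′ : W} → (u , v) ≡ (u′ , v′) → u ≡ u′ × v ≡ v′
    unends refl = refl , refl

    ⟦⟧-injective : ∀ {u v} → ⟦ u ⟧ ≡ ⟦ v ⟧ → u ≡ v
    ⟦⟧-injective = ↔-injective W↔V

  -- The indexing of the edges, and neighbourhood sums over named vertices.

  module Edges (next≢id : ∀ (k : Fin s) → next k ≢ k) where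

    private
      rung≢arc : ∀ k l → ends (rung k) ≢ ends (arc l)
      rung≢arc k l eq with unends eq
      ... | X≡ , Y≡ = next≢id l (trans (sym (rim-injective X≡)) (rim-injective Y≡))

      ends-injective : ∀ a b → ends a ≡ ends b → a ≡ b
      ends-injective (link i)        (link i)        refl = refl
      ends-injective (cross i t k b) (cross i t k b) refl = refl
      ends-injective (axle i t)      (axle i t)      refl = refl
      ends-injective (rung k)        (rung k)        refl = refl
      ends-injective (rung k)        (arc l)         eq   = contradiction eq (rung≢arc k l)
      ends-injective (arc k)         (rung l)        eq   = contradiction (sym eq) (rung≢arc l k)
      ends-injective (arc k)         (arc l)         eq   = cong arc (rim-injective (proj₂ (unends eq)))
      ends-injective (spoke k b)     (spoke k b)     refl = refl

      edge : Link → Edge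
      edge e = mkEdge {⟦ proj₁ (ends e) ⟧} {⟦ proj₂ (ends e) ⟧} (ends-adjacent e)

      edge-injective : ∀ {a b} → edge a ≈ᴱ edge b → a ≡ b
      edge-injective {a} {b} (inj₁ (p , q)) = ends-injective a b
        (cong₂ _,_ (⟦⟧-injective {proj₁ (ends a)} {proj₁ (ends b)} p)
                   (⟦⟧-injective {proj₂ (ends a)} {proj₂ (ends b)} q))
      edge-injective {a} {b} (inj₂ (p , q)) = contradiction (rank-ends a)
        (ℕₚ.<-asym (subst₂ (λ u v → rank u < rank v)
          (sym (⟦⟧-injective {proj₂ (ends a)} {proj₁ (ends b)} q))
          (sym (⟦⟧-injective {proj₁ (ends a)} {proj₂ (ends b)} p))
          (rank-ends b)))

      joins⇒≈ᴱ : ∀ e {u v} (adj : ⟦ u ⟧ ~ ⟦ v ⟧) → Joins e u v → edge e ≈ᴱ mkEdge {⟦ u ⟧} {⟦ v ⟧} adj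
      joins⇒≈ᴱ e adj (inj₁ refl) = inj₁ (refl , refl)
      joins⇒≈ᴱ e adj (inj₂ refl) = inj₂ (refl , refl)

      edge-surjective : ∀ e → ∃[ a ] edge a ≈ᴱ e
      edge-surjective e = via (adjacent⇒joins u v (subst₂ _~_ (sym ⟦u⟧≡) (sym ⟦v⟧≡) (Edge.adjacent e)))
        where
        u v : W
        u = Inverse.from W↔V (Edge.end₁ e)
        v = Inverse.from W↔V (Edge.end₂ e)
        ⟦u⟧≡ : ⟦ u ⟧ ≡ Edge.end₁ e
        ⟦u⟧≡ = Inverse.strictlyInverseˡ W↔V _
        ⟦v⟧≡ : ⟦ v ⟧ ≡ Edge.end₂ e
        ⟦v⟧≡ = Inverse.strictlyInverseˡ W↔V _
        via : ∃[ a ] Joins a u v → ∃[ a ] edge a ≈ᴱ e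
        via (a , inj₁ eq) with unends eq
        ... | p , q = a , inj₁ (trans (cong ⟦_⟧ p) ⟦u⟧≡ , trans (cong ⟦_⟧ q) ⟦v⟧≡)
        via (a , inj₂ eq) with unends eq
        ... | p , q = a , inj₂ (trans (cong ⟦_⟧ p) ⟦v⟧≡ , trans (cong ⟦_⟧ q) ⟦u⟧≡)

    edges : EdgeIndexing G Link
    edges = record { edge = edge ; injective = edge-injective ; surjective = edge-surjective }

    module Labelled {T} (position : (W ⊎ Link) ↔ Fin T) where

      private
        position′ : (V ⊎ Link) ↔ Fin T
        position′ = ↔-trans (↔-sym W↔V ⊎-↔ ↔-refl) position

      f : TotalLabeling G
      f = EdgeIndexing.labeling edges position′

      ℓ : W ⊎ Link → ℕ
      ℓ x = suc (toℕ⟨ position ⟩ x)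

      term : W → W → ℕ
      term u v = summand G f {⟦ u ⟧} {⟦ v ⟧} (⟦ u ⟧ ~? ⟦ v ⟧)

      -- The adjacency proof inside the decision is arbitrary, but the label depends only on the
      -- unordered edge.
      term-joins : ∀ {u v} e → Joins e u v → term u v ≡ ℓ (inj₂ e) + ℓ (inj₁ v)
      term-joins {u} {v} e j = lemma (⟦ u ⟧ ~? ⟦ v ⟧)
        where
        lemma : (d : Dec (⟦ u ⟧ ~ ⟦ v ⟧)) → summand G f {⟦ u ⟧} {⟦ v ⟧} d ≡ ℓ (inj₂ e) + ℓ (inj₁ v)
        lemma (yes u~v) = cong₂ _+_
          (EdgeIndexing.label-edge edges position′ e (mkEdge {⟦ u ⟧} {⟦ v ⟧} u~v) (joins⇒≈ᴱ e u~v j))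
          (trans (EdgeIndexing.label-vertex edges position′ ⟦ v ⟧)
                 (cong (λ w → ℓ (inj₁ w)) (Inverse.strictlyInverseʳ W↔V v)))
        lemma (no u≁v)  = contradiction (joins⇒adjacent e j) u≁v

      term-apart : ∀ {u v} → (∀ e → ¬ Joins e u v) → term u v ≡ 0
      term-apart {u} {v} ¬j = lemma (⟦ u ⟧ ~? ⟦ v ⟧)
        where
        lemma : (d : Dec (⟦ u ⟧ ~ ⟦ v ⟧)) → summand G f {⟦ u ⟧} {⟦ v ⟧} d ≡ 0
        lemma (no _)    = refl
        lemma (yes u~v) = contradiction (proj₂ (adjacent⇒joins u v u~v)) (¬j _)

      f⁺tn-terms : ∀ u → f⁺tn G f ⟦ u ⟧ ≡
        sum (λ i → term u (apex i 0F) + term u (apex i 1F)) +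
        (sum (λ k → term u (rim k 0F) + term u (rim k 1F)) + term u hub)
      f⁺tn-terms u = sum-vertices (λ v → summand G f {⟦ u ⟧} {v} (⟦ u ⟧ ~? v))

-- The labeling

module Layout (r s : ℕ) where

  open Construction r s using (W; Link; link; cross; axle; rung; arc; spoke)

  -- From bottom to top: the lower and the upper halves of the blocks, the vertices
  -- aᵢ , bᵢ, the rim, the hub, the rim edges, the spokes, the edges aᵢbᵢ, and the
  -- edges from aᵢ , bᵢ to the hub.
  cells pairs segments : Shape
  cells    = fin r ⊗ (fin 2 ⊗ fin s)
  pairs    = fin s ⊗ fin 2
  segments = cells ⊕ flip cells ⊕ (fin r ⊗ fin 2) ⊕ pairs ⊕ fin 1 ⊕ pairs ⊕ pairs ⊕ fin r ⊕ (fin 2 ⊗ fin r)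

  pattern low-  x = inj₁ x
  pattern high- x = inj₂ (inj₁ x)
  pattern F- x = inj₂ (inj₂ (inj₁ x))
  pattern V- x = inj₂ (inj₂ (inj₂ (inj₁ x)))
  pattern H- x = inj₂ (inj₂ (inj₂ (inj₂ (inj₁ x))))
  pattern C- x = inj₂ (inj₂ (inj₂ (inj₂ (inj₂ (inj₁ x)))))
  pattern D- x = inj₂ (inj₂ (inj₂ (inj₂ (inj₂ (inj₂ (inj₁ x))))))
  pattern E- x = inj₂ (inj₂ (inj₂ (inj₂ (inj₂ (inj₂ (inj₂ (inj₁ x)))))))
  pattern O- x = inj₂ (inj₂ (inj₂ (inj₂ (inj₂ (inj₂ (inj₂ (inj₂ x)))))))

  -- `opposite` marks labels that fall as the index grows, so that they balance rising ones. The
  -- spoke at yₖ follows `next k`, to balance the label of the x in the next column. The four edges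
  -- of a block use one cell per apex, taken once from below and once from above.
  to : W ⊎ Link → El segments
  to (inj₁ (apex i 0F))        = F- (opposite i , 1F)
  to (inj₁ (apex i 1F))        = F- (opposite i , 0F)
  to (inj₁ (rim k 0F))         = V- (opposite k , 0F)
  to (inj₁ (rim k 1F))         = V- (k , 1F)
  to (inj₁ hub)                = H- 0F
  to (inj₂ (link i))           = E- i
  to (inj₂ (cross i 0F k 0F))  = low- (i , 0F , mirror i 0F k)
  to (inj₂ (cross i 0F k 1F))  = high- (i , 0F , mirror i 0F k)
  to (inj₂ (cross i 1F k 0F))  = high- (i , 1F , mirror i 1F k)
  to (inj₂ (cross i 1F k 1F))  = low- (i , 1F , mirror i 1F k)
  to (inj₂ (axle i t))         = O- (t , i)
  to (inj₂ (rung k))           = C- (k , 0F)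
  to (inj₂ (arc k))            = C- (opposite k , 1F)
  to (inj₂ (spoke k 0F))       = D- (opposite k , 0F)
  to (inj₂ (spoke k 1F))       = D- (next k , 1F)

  from : El segments → W ⊎ Link
  from (low- (i , 0F , k))  = inj₂ (cross i 0F (mirror i 0F k) 0F)
  from (low- (i , 1F , k))  = inj₂ (cross i 1F (mirror i 1F k) 1F)
  from (high- (i , 0F , k)) = inj₂ (cross i 0F (mirror i 0F k) 1F)
  from (high- (i , 1F , k)) = inj₂ (cross i 1F (mirror i 1F k) 0F)
  from (F- (i , 0F))        = inj₁ (apex (opposite i) 1F)
  from (F- (i , 1F))        = inj₁ (apex (opposite i) 0F)
  from (V- (k , 0F))        = inj₁ (rim (opposite k) 0F)
  from (V- (k , 1F))        = inj₁ (rim k 1F)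
  from (H- 0F)              = inj₁ hub
  from (C- (k , 0F))        = inj₂ (rung k)
  from (C- (k , 1F))        = inj₂ (arc (opposite k))
  from (D- (k , 0F))        = inj₂ (spoke (opposite k) 0F)
  from (D- (k , 1F))        = inj₂ (spoke (prev k) 1F)
  from (E- i)               = inj₂ (link i)
  from (O- (t , i))         = inj₂ (axle i t)

  to∘from : ∀ x → to (from x) ≡ x
  to∘from (low- (i , 0F , k))  = cong (λ j → low- (i , 0F , j)) (mirror-involutive i 0F k)
  to∘from (low- (i , 1F , k))  = cong (λ j → low- (i , 1F , j)) (mirror-involutive i 1F k)
  to∘from (high- (i , 0F , k)) = cong (λ j → high- (i , 0F , j)) (mirror-involutive i 0F k)
  to∘from (high- (i , 1F , k)) = cong (λ j → high- (i , 1F , j)) (mirror-involutive i 1F k)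
  to∘from (F- (i , 0F))        = cong (λ j → F- (j , 0F)) (Finₚ.opposite-involutive i)
  to∘from (F- (i , 1F))        = cong (λ j → F- (j , 1F)) (Finₚ.opposite-involutive i)
  to∘from (V- (k , 0F))        = cong (λ j → V- (j , 0F)) (Finₚ.opposite-involutive k)
  to∘from (V- (k , 1F))        = refl
  to∘from (H- 0F)              = refl
  to∘from (C- (k , 0F))        = refl
  to∘from (C- (k , 1F))        = cong (λ j → C- (j , 1F)) (Finₚ.opposite-involutive k)
  to∘from (D- (k , 0F))        = cong (λ j → D- (j , 0F)) (Finₚ.opposite-involutive k)
  to∘from (D- (k , 1F))        = cong (λ j → D- (j , 1F)) (next-prev k)
  to∘from (E- i)               = refl
  to∘from (O- (t , i))         = refl

  from∘to : ∀ x → from (to x) ≡ x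
  from∘to (inj₁ (apex i 0F))        = cong (λ j → inj₁ (apex j 0F)) (Finₚ.opposite-involutive i)
  from∘to (inj₁ (apex i 1F))        = cong (λ j → inj₁ (apex j 1F)) (Finₚ.opposite-involutive i)
  from∘to (inj₁ (rim k 0F))         = cong (λ j → inj₁ (rim j 0F)) (Finₚ.opposite-involutive k)
  from∘to (inj₁ (rim k 1F))         = refl
  from∘to (inj₁ hub)                = refl
  from∘to (inj₂ (link i))           = refl
  from∘to (inj₂ (cross i 0F k 0F))  = cong (λ j → inj₂ (cross i 0F j 0F)) (mirror-involutive i 0F k)
  from∘to (inj₂ (cross i 0F k 1F))  = cong (λ j → inj₂ (cross i 0F j 1F)) (mirror-involutive i 0F k)
  from∘to (inj₂ (cross i 1F k 0F))  = cong (λ j → inj₂ (cross i 1F j 0F)) (mirror-involutive i 1F k)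
  from∘to (inj₂ (cross i 1F k 1F))  = cong (λ j → inj₂ (cross i 1F j 1F)) (mirror-involutive i 1F k)
  from∘to (inj₂ (axle i t))         = refl
  from∘to (inj₂ (rung k))           = refl
  from∘to (inj₂ (arc k))            = cong (λ j → inj₂ (arc j)) (Finₚ.opposite-involutive k)
  from∘to (inj₂ (spoke k 0F))       = cong (λ j → inj₂ (spoke j 0F)) (Finₚ.opposite-involutive k)
  from∘to (inj₂ (spoke k 1F))       = cong (λ j → inj₂ (spoke j 1F)) (prev-next k)

  arrange : (W ⊎ Link) ↔ El segments
  arrange = mk↔ₛ′ to from to∘from from∘to

  position : (W ⊎ Link) ↔ Fin ∣ segments ∣
  position = ↔-trans arrange (index segments)

  -- Opaque, since conversion checking would otherwise unfold these to unary
  -- arithmetic.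
  opaque
    R F V H C D E O : ℕ
    R = r * (2 * s)
    F = R + R
    V = F + r * 2
    H = V + s * 2
    C = H + 1
    D = C + s * 2
    E = D + s * 2
    O = E + r

  low : Fin r → Fin 2 → Fin s → ℕ
  low i t k = 2 * s * toℕ i + (s * toℕ t + toℕ k)

  -- Left as an opposite index: it enters the colours only through its sum with `low`.
  high : Fin r → Fin 2 → Fin s → ℕ
  high i t k = toℕ (opposite (Inverse.to (index cells) (i , t , k)))

  -- The labels as arithmetic expressions. Summands such as `+ 0` are kept so that every clause
  -- agrees with `offset` by computation.
  ℓ′ : W ⊎ Link → ℕ
  ℓ′ (inj₁ (apex i 0F))       = suc (F + (2 * toℕ (opposite i) + 1))
  ℓ′ (inj₁ (apex i 1F))       = suc (F + (2 * toℕ (opposite i) + 0))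
  ℓ′ (inj₁ (rim k 0F))        = suc (V + (2 * toℕ (opposite k) + 0))
  ℓ′ (inj₁ (rim k 1F))        = suc (V + (2 * toℕ k + 1))
  ℓ′ (inj₁ hub)               = suc (H + 0)
  ℓ′ (inj₂ (link i))          = suc (E + toℕ i)
  ℓ′ (inj₂ (cross i 0F k 0F)) = suc (low i 0F (mirror i 0F k))
  ℓ′ (inj₂ (cross i 0F k 1F)) = suc (R + high i 0F (mirror i 0F k))
  ℓ′ (inj₂ (cross i 1F k 0F)) = suc (R + high i 1F (mirror i 1F k))
  ℓ′ (inj₂ (cross i 1F k 1F)) = suc (low i 1F (mirror i 1F k))
  ℓ′ (inj₂ (axle i t))        = suc (O + (r * toℕ t + toℕ i))
  ℓ′ (inj₂ (rung k))          = suc (C + (2 * toℕ k + 0))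
  ℓ′ (inj₂ (arc k))           = suc (C + (2 * toℕ (opposite k) + 1))
  ℓ′ (inj₂ (spoke k 0F))      = suc (D + (2 * toℕ (opposite k) + 0))
  ℓ′ (inj₂ (spoke k 1F))      = suc (D + (2 * toℕ (next k) + 1))

  opaque
    unfolding R

    -- The upper half numbers the same cells backwards.
    low+high : ∀ i t k → suc (low i t k + high i t k) ≡ R
    low+high i t k = trans (cong (λ x → suc (x + high i t k)) (sym (offset≡ cells 0 (i , t , k))))
      (1+toℕ+opposite (Inverse.to (index cells) (i , t , k)))

    position≡ℓ′ : ∀ x → suc (toℕ⟨ position ⟩ x) ≡ ℓ′ x
    position≡ℓ′ x = trans (cong suc (offset≡ segments 0 (to x))) (offset≡ℓ′ x)
      where
      offset≡ℓ′ : ∀ x → suc (offset segments 0 (to x)) ≡ ℓ′ x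
      offset≡ℓ′ (inj₁ (apex i 0F))       = refl
      offset≡ℓ′ (inj₁ (apex i 1F))       = refl
      offset≡ℓ′ (inj₁ (rim k 0F))        = refl
      offset≡ℓ′ (inj₁ (rim k 1F))        = refl
      offset≡ℓ′ (inj₁ hub)               = refl
      offset≡ℓ′ (inj₂ (link i))          = refl
      offset≡ℓ′ (inj₂ (cross i 0F k 0F)) = refl
      offset≡ℓ′ (inj₂ (cross i 0F k 1F)) = refl
      offset≡ℓ′ (inj₂ (cross i 1F k 0F)) = refl
      offset≡ℓ′ (inj₂ (cross i 1F k 1F)) = refl
      offset≡ℓ′ (inj₂ (axle i t))        = refl
      offset≡ℓ′ (inj₂ (rung k))          = refl
      offset≡ℓ′ (inj₂ (arc k))           = refl
      offset≡ℓ′ (inj₂ (spoke k 0F))      = refl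
      offset≡ℓ′ (inj₂ (spoke k 1F))      = refl

  opaque
    -- The labels on all edges from one rim vertex to the apexes. Sealed, like `A`, so that the
    -- colour identities treat it as an unknown.
    column : Fin s → Fin 2 → ℕ
    column k b = sum (λ i → ℓ′ (inj₂ (cross i 0F k b)) + ℓ′ (inj₂ (cross i 1F k b)))

    column≡ : ∀ k b → column k b ≡ sum (λ i → ℓ′ (inj₂ (cross i 0F k b)) + ℓ′ (inj₂ (cross i 1F k b)))
    column≡ k b = refl

    A : ℕ
    A = sum (λ i → ℓ′ (inj₁ (apex i 0F)) + ℓ′ (inj₁ (apex i 1F)))

    A≡ : A ≡ sum (λ i → ℓ′ (inj₁ (apex i 0F)) + ℓ′ (inj₁ (apex i 1F)))
    A≡ = refl

  α β : ℕ
  α = E + F + O + H + (2 * r + 2) + s * (suc (R + R) + (2 * V + (2 * s + 1)))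
  β = suc r + α

-- The colours

+-nullʳ : ∀ {a b c} → a ≡ c → b ≡ 0 → a + b ≡ c
+-nullʳ {a} refl refl = ℕₚ.+-identityʳ a

+-nullˡ : ∀ {a b c} → a ≡ 0 → b ≡ c → a + b ≡ c
+-nullˡ refl refl = refl

swapʳ : ∀ a b c → (a + b) + c ≡ (a + c) + b
swapʳ = solve-∀

rowPair : ∀ R a b → suc (a + b) ≡ R → suc a + suc (R + b) ≡ suc (R + R)
rowPair _ a b refl = solve (a ∷ b ∷ [])

-- The labels of aᵢbᵢ and of the axle each rise by one with `i`, while the label of bᵢ falls by two.
-- Substituting for `r` leaves a polynomial identity.
apexColour₀ : ∀ E F O H r i o z → suc (i + o) ≡ r →
  (suc (E + i) + suc (F + (2 * o + 0))) + (z + (suc (O + (r * 0 + i)) + suc (H + 0))) ≡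
  E + F + O + H + (2 * r + 2) + z
apexColour₀ E F O H _ i o z refl = solve (E ∷ F ∷ O ∷ H ∷ i ∷ o ∷ z ∷ [])

-- The excess `suc r` consists of 1 from the label of the partner and `r` from the axle.
apexColour₁ : ∀ E F O H r i o z → suc (i + o) ≡ r →
  (suc (E + i) + suc (F + (2 * o + 1))) + (z + (suc (O + (r * 1 + i)) + suc (H + 0))) ≡
  suc r + (E + F + O + H + (2 * r + 2) + z)
apexColour₁ E F O H _ i o z refl = solve (E ∷ F ∷ O ∷ H ∷ i ∷ o ∷ z ∷ [])

rimPair : ∀ V s k o → suc (k + o) ≡ s → suc (V + (2 * o + 0)) + suc (V + (2 * k + 1)) ≡ 2 * V + (2 * s + 1)
rimPair V _ k o refl = solve (V ∷ k ∷ o ∷ [])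

apexPair : ∀ F o → suc (F + (2 * o + 1)) + suc (F + (2 * o + 0)) ≡ 2 * F + 3 + 4 * o
apexPair = solve-∀

-- Here `m` is the column before `k`, and primes mark opposites. The arc balances the label of yₘ.
-- Rung and yₖ give 4k, half of it balanced by the spoke and half by the column sum.
rimColour₀ : ∀ A C V D H s m m′ k k′ z Z → suc (m + m′) ≡ s → suc (k + k′) ≡ s → z + 2 * k ≡ Z →
  (z + A) + (((suc (C + (2 * m′ + 1)) + suc (V + (2 * m + 1))) + (suc (C + (2 * k + 0)) + suc (V + (2 * k + 1)))) +
    (suc (D + (2 * k′ + 0)) + suc (H + 0))) ≡
  A + (Z + (2 * C + 2 * V + D + H) + (2 * s + 2 * s + 5))
rimColour₀ A C V D H s m m′ k k′ z Z m+m′ k+k′ z+2k = trans (lemma A C V D H m m′ k k′ z)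
  (cong₂ (λ x y → A + (x + (2 * C + 2 * V + D + H) + (y + 5))) z+2k (cong₂ (λ x y → 2 * x + 2 * y) m+m′ k+k′))
  where
  lemma : ∀ A C V D H m m′ k k′ z →
    (z + A) + (((suc (C + (2 * m′ + 1)) + suc (V + (2 * m + 1))) + (suc (C + (2 * k + 0)) + suc (V + (2 * k + 1)))) +
      (suc (D + (2 * k′ + 0)) + suc (H + 0))) ≡
    A + ((z + 2 * k) + (2 * C + 2 * V + D + H) + (2 * suc (m + m′) + 2 * suc (k + k′) + 5))
  lemma = solve-∀

-- Here `k` is the column after `m`. The shifted spoke balances the x of that column, and the column
-- sum absorbs the surplus 2m′.
rimColour₁ : ∀ A C V D H s m m′ k k′ z Z → suc (m + m′) ≡ s → suc (k + k′) ≡ s → z + 2 * m′ ≡ Z →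
  (z + A) + (((suc (C + (2 * m + 0)) + suc (V + (2 * m′ + 0))) + (suc (C + (2 * m′ + 1)) + suc (V + (2 * k′ + 0)))) +
    (suc (D + (2 * k + 1)) + suc (H + 0))) ≡
  A + (Z + (2 * C + 2 * V + D + H) + (2 * s + 2 * s + 4))
rimColour₁ A C V D H s m m′ k k′ z Z m+m′ k+k′ z+2m′ = trans (lemma A C V D H m m′ k k′ z)
  (cong₂ (λ x y → A + (x + (2 * C + 2 * V + D + H) + (y + 4))) z+2m′ (cong₂ (λ x y → 2 * x + 2 * y) m+m′ k+k′))
  where
  lemma : ∀ A C V D H m m′ k k′ z →
    (z + A) + (((suc (C + (2 * m + 0)) + suc (V + (2 * m′ + 0))) + (suc (C + (2 * m′ + 1)) + suc (V + (2 * k′ + 0)))) +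
      (suc (D + (2 * k + 1)) + suc (H + 0))) ≡
    A + ((z + 2 * m′) + (2 * C + 2 * V + D + H) + (2 * suc (m + m′) + 2 * suc (k + k′) + 4))
  lemma = solve-∀

-- Both labels fall as `k` grows: the lower one is mirrored, the upper one is numbered backwards.
-- Hence slope -2.
mirroredColumn₀ : ∀ R s k o h → suc (k + o) ≡ s → suc (2 * s * 0 + (s * 1 + k) + h) ≡ R →
  (suc (2 * s * 0 + (s * 0 + o)) + suc (R + h)) + 2 * k ≡ R + R
mirroredColumn₀ _ _ k o h refl refl = solve (k ∷ o ∷ h ∷ [])

mirroredColumn₁ : ∀ R s k o h → suc (k + o) ≡ s → suc (2 * s * 0 + (s * 0 + o) + h) ≡ R →
  (suc (R + h) + suc (2 * s * 0 + (s * 1 + k))) + 2 * o ≡ R + R + s + s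
mirroredColumn₁ _ _ k o h refl refl = solve (k ∷ o ∷ h ∷ [])

-- Without mirroring, the lower label rises as fast as the upper one falls. `R′` stands for R - s.
column₀ : ∀ R R′ s i k h → suc (2 * s * i + (s * 1 + k) + h) ≡ R → R ≡ s + R′ →
  suc (2 * s * i + (s * 0 + k)) + suc (R + h) ≡ suc (R + R′)
column₀ R R′ s i k h eq R≡ = ℕₚ.+-cancelʳ-≡ s _ _ (begin
  suc (2 * s * i + (s * 0 + k)) + suc (R + h) + s ≡⟨ lemma R s i k h ⟩
  suc (R + suc (2 * s * i + (s * 1 + k) + h))     ≡⟨ cong (λ x → suc (R + x)) (trans eq (trans R≡ (ℕₚ.+-comm s R′))) ⟩
  suc (R + (R′ + s))                              ≡⟨ cong suc (ℕₚ.+-assoc R R′ s) ⟨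
  suc (R + R′) + s                                ∎)
  where
  open ≡-Reasoning
  lemma : ∀ R s i k h → suc (2 * s * i + (s * 0 + k)) + suc (R + h) + s ≡ suc (R + suc (2 * s * i + (s * 1 + k) + h))
  lemma = solve-∀

column₁ : ∀ R s i k h → suc (2 * s * i + (s * 0 + k) + h) ≡ R →
  suc (R + h) + suc (2 * s * i + (s * 1 + k)) ≡ suc (R + R + s)
column₁ _ s i k h refl = solve (s ∷ i ∷ k ∷ h ∷ [])

-- Column sums and the constants in the colour estimates, for r = w + 1.

module Bounds (w s : ℕ) where

  open Layout (suc w) s public

  opaque
    unfolding R

    -- Exhibits R - s without subtraction, as `column₀` requires.
    R≡ : R ≡ s + (s + w * (2 * s))
    R≡ = lemma w s
      where
      lemma : ∀ w s → suc w * (2 * s) ≡ s + (s + w * (2 * s))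
      lemma = solve-∀

  -- ξ = A + ξ₀, η = A + η₀, A⁻ ≤ A ≤ A⁺ and θ₁ + A + θ₂ ≤ θ.
  Z₀ Z₁ A⁻ A⁺ ξ₀ η₀ θ₁ θ₂ : ℕ
  Z₀ = R + R + w * suc (R + (s + w * (2 * s)))
  Z₁ = R + R + s + s + w * suc (R + R + s)
  A⁻ = suc w * (2 * F + 3)
  A⁺ = suc w * (2 * F + 3 + 4 * w)
  ξ₀ = Z₀ + (2 * C + 2 * V + D + H) + (2 * s + 2 * s + 5)
  η₀ = Z₁ + (2 * C + 2 * V + D + H) + (2 * s + 2 * s + 4)
  θ₁ = suc w * (2 * suc O)
  θ₂ = s * (2 * suc D + (2 * V + (2 * s + 1)))

-- Row 0 contributes slope -2 in `k`; every other row contributes the constant `c`.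
columnSum₀ : ∀ w s k → let open Bounds w s in
  column k 0F + 2 * toℕ k ≡ Z₀
columnSum₀ w s k = begin
  column k 0F + 2 * toℕ k      ≡⟨ cong (_+ 2 * toℕ k) (column≡ k 0F) ⟩
  (top + sum rest) + 2 * toℕ k ≡⟨ cong (λ x → top + x + 2 * toℕ k) (sum-const _ rest≡) ⟩
  (top + w * c) + 2 * toℕ k    ≡⟨ swapʳ top (w * c) (2 * toℕ k) ⟩
  (top + 2 * toℕ k) + w * c    ≡⟨ cong (_+ w * c) (mirroredColumn₀ R s (toℕ k) (toℕ (opposite k)) _
                                    (1+toℕ+opposite k) (low+high 0F 1F k)) ⟩
  R + R + w * c                ∎
  where
  open ≡-Reasoning
  open Bounds w s
  open Construction (suc w) s using (cross)
  c top : ℕ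
  c = suc (R + (s + w * (2 * s)))
  top = ℓ′ (inj₂ (cross 0F 0F k 0F)) + ℓ′ (inj₂ (cross 0F 1F k 0F))
  rest : Fin w → ℕ
  rest i = ℓ′ (inj₂ (cross (suc i) 0F k 0F)) + ℓ′ (inj₂ (cross (suc i) 1F k 0F))
  rest≡ : ∀ i → rest i ≡ c
  rest≡ i = column₀ R (s + w * (2 * s)) s (toℕ (suc i)) (toℕ k) _ (low+high (suc i) 1F k) R≡

-- The slope is +2 here; adding twice the opposite index compensates it without subtraction.
columnSum₁ : ∀ w s k → let open Bounds w s in
  column k 1F + 2 * toℕ (opposite k) ≡ Z₁
columnSum₁ w s k = begin
  column k 1F + 2 * o      ≡⟨ cong (_+ 2 * o) (column≡ k 1F) ⟩
  (top + sum rest) + 2 * o ≡⟨ cong (λ x → top + x + 2 * o) (sum-const _ rest≡) ⟩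
  (top + w * c) + 2 * o    ≡⟨ swapʳ top (w * c) (2 * o) ⟩
  (top + 2 * o) + w * c    ≡⟨ cong (_+ w * c) (mirroredColumn₁ R s (toℕ k) o _
                                (1+toℕ+opposite k) (low+high 0F 0F (opposite k))) ⟩
  R + R + s + s + w * c    ∎
  where
  open ≡-Reasoning
  open Bounds w s
  open Construction (suc w) s using (cross)
  c o top : ℕ
  c = suc (R + R + s)
  o = toℕ (opposite k)
  top = ℓ′ (inj₂ (cross 0F 0F k 1F)) + ℓ′ (inj₂ (cross 0F 1F k 1F))
  rest : Fin w → ℕ
  rest i = ℓ′ (inj₂ (cross (suc i) 0F k 1F)) + ℓ′ (inj₂ (cross (suc i) 1F k 1F))
  rest≡ : ∀ i → rest i ≡ c
  rest≡ i = column₁ R s (toℕ (suc i)) (toℕ k) _ (low+high (suc i) 0F k)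

-- The colour of each kind of vertex.

module Colours (r s : ℕ) (next≢id : ∀ (k : Fin s) → next k ≢ k) where

  open Construction r s public
  open Edges next≢id public
  open Layout r s public
  open Labelled position public

  private
    joined : ∀ {u v} e → Joins e u v → term u v ≡ ℓ′ (inj₂ e) + ℓ′ (inj₁ v)
    joined {v = v} e j = trans (term-joins e j)
      (cong₂ _+_ (position≡ℓ′ (inj₂ e)) (position≡ℓ′ (inj₁ v)))

    apexes : ∀ e {i j t t′} → ends e ≡ (apex i t , apex j t′) → i ≡ j × t ≢ t′
    apexes (link i) refl = refl , λ ()

    rims : ∀ e {k l b c} → ends e ≡ (rim k b , rim l c) → b ≢ c × (k ≡ l ⊎ k ≡ next l)
    rims (rung k) refl = (λ ()) , inj₁ refl
    rims (arc k)  refl = (λ ()) , inj₂ refl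

    rims₁₀ : ∀ e {k l} → ends e ≢ (rim k 1F , rim l 0F)
    rims₁₀ (rung k) ()
    rims₁₀ (arc k)  ()

    apart-apex : ∀ i j t t′ → (i ≡ j → t ≡ t′) → term (apex i t) (apex j t′) ≡ 0
    apart-apex i j t t′ i≡j→t≡t′ = term-apart {apex i t} {apex j t′} λ where
      e (inj₁ eq) → let p , q = apexes e eq in q (i≡j→t≡t′ p)
      e (inj₂ eq) → let p , q = apexes e eq in q (sym (i≡j→t≡t′ (sym p)))

    apart-rim : ∀ k l b → term (rim k b) (rim l b) ≡ 0
    apart-rim k l b = term-apart {rim k b} {rim l b} λ where
      e (inj₁ eq) → proj₁ (rims e eq) refl
      e (inj₂ eq) → proj₁ (rims e eq) refl

    apart-rim₀₁ : ∀ k l → k ≢ l → k ≢ next l → term (rim k 0F) (rim l 1F) ≡ 0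
    apart-rim₀₁ k l k≢l k≢next = term-apart {rim k 0F} {rim l 1F} λ where
      e (inj₁ eq) → [ k≢l , k≢next ] (proj₂ (rims e eq))
      e (inj₂ eq) → rims₁₀ e eq

    apart-rim₁₀ : ∀ k l → l ≢ k → l ≢ next k → term (rim k 1F) (rim l 0F) ≡ 0
    apart-rim₁₀ k l l≢k l≢next = term-apart {rim k 1F} {rim l 0F} λ where
      e (inj₁ eq) → rims₁₀ e eq
      e (inj₂ eq) → [ l≢k , l≢next ] (proj₂ (rims e eq))

    apart-hub : term hub hub ≡ 0
    apart-hub = term-apart {hub} {hub} λ e j → Graph.~-irrefl G {⟦ hub ⟧} (joins⇒adjacent e j)

    -- All columns contribute equally: the two crossing edges have complementary labels, and the
    -- labels of xₖ and yₖ move in opposite directions.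
    overRim : ∀ i t →
      sum (λ k → term (apex i t) (rim k 0F) + term (apex i t) (rim k 1F)) ≡ s * (suc (R + R) + (2 * V + (2 * s + 1)))
    overRim i t = sum-const _ λ k → begin
      term (apex i t) (rim k 0F) + term (apex i t) (rim k 1F)
        ≡⟨ cong₂ _+_ (joined (cross i t k 0F) (inj₁ refl)) (joined (cross i t k 1F) (inj₁ refl)) ⟩
      (ℓ′ (inj₂ (cross i t k 0F)) + ℓ′ (inj₁ (rim k 0F))) + (ℓ′ (inj₂ (cross i t k 1F)) + ℓ′ (inj₁ (rim k 1F)))
        ≡⟨ +-interchange (ℓ′ (inj₂ (cross i t k 0F))) _ _ _ ⟩
      (ℓ′ (inj₂ (cross i t k 0F)) + ℓ′ (inj₂ (cross i t k 1F))) + (ℓ′ (inj₁ (rim k 0F)) + ℓ′ (inj₁ (rim k 1F)))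
        ≡⟨ cong₂ _+_ (row t k) (rimPair V s (toℕ k) (toℕ (opposite k)) (1+toℕ+opposite k)) ⟩
      suc (R + R) + (2 * V + (2 * s + 1)) ∎
      where
      open ≡-Reasoning
      row : ∀ t k → ℓ′ (inj₂ (cross i t k 0F)) + ℓ′ (inj₂ (cross i t k 1F)) ≡ suc (R + R)
      row 0F k = rowPair R _ _ (low+high i 0F (mirror i 0F k))
      row 1F k = trans (ℕₚ.+-comm (ℓ′ (inj₂ (cross i 1F k 0F))) _) (rowPair R _ _ (low+high i 1F (mirror i 1F k)))

  apex₀-colour : ∀ i → f⁺tn G f ⟦ apex i 0F ⟧ ≡ α
  apex₀-colour i = begin
    f⁺tn G f ⟦ apex i 0F ⟧
      ≡⟨ f⁺tn-terms (apex i 0F) ⟩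
    sum (λ j → term (apex i 0F) (apex j 0F) + term (apex i 0F) (apex j 1F)) +
    (sum (λ k → term (apex i 0F) (rim k 0F) + term (apex i 0F) (rim k 1F)) + term (apex i 0F) hub)
      ≡⟨ cong₂ _+_
           -- Among the apexes only the partner bᵢ is a neighbour.
           (trans (sum-only i λ j j≢i → cong₂ _+_
                     (apart-apex i j 0F 0F λ _ → refl)
                     (apart-apex i j 0F 1F λ i≡j → contradiction (sym i≡j) j≢i))
                  (+-nullˡ (apart-apex i i 0F 0F λ _ → refl) (joined (link i) (inj₁ refl))))
           (cong₂ _+_ (overRim i 0F) (joined (axle i 0F) (inj₁ refl))) ⟩
    (ℓ′ (inj₂ (link i)) + ℓ′ (inj₁ (apex i 1F))) +
    (s * (suc (R + R) + (2 * V + (2 * s + 1))) + (ℓ′ (inj₂ (axle i 0F)) + ℓ′ (inj₁ hub)))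
      ≡⟨ apexColour₀ E F O H r (toℕ i) (toℕ (opposite i))
           (s * (suc (R + R) + (2 * V + (2 * s + 1)))) (1+toℕ+opposite i) ⟩
    α ∎
    where open ≡-Reasoning

  apex₁-colour : ∀ i → f⁺tn G f ⟦ apex i 1F ⟧ ≡ β
  apex₁-colour i = begin
    f⁺tn G f ⟦ apex i 1F ⟧
      ≡⟨ f⁺tn-terms (apex i 1F) ⟩
    sum (λ j → term (apex i 1F) (apex j 0F) + term (apex i 1F) (apex j 1F)) +
    (sum (λ k → term (apex i 1F) (rim k 0F) + term (apex i 1F) (rim k 1F)) + term (apex i 1F) hub)
      ≡⟨ cong₂ _+_
           (trans (sum-only i λ j j≢i → cong₂ _+_
                     (apart-apex i j 1F 0F λ i≡j → contradiction (sym i≡j) j≢i)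
                     (apart-apex i j 1F 1F λ _ → refl))
                  (+-nullʳ (joined (link i) (inj₂ refl)) (apart-apex i i 1F 1F λ _ → refl)))
           (cong₂ _+_ (overRim i 1F) (joined (axle i 1F) (inj₁ refl))) ⟩
    (ℓ′ (inj₂ (link i)) + ℓ′ (inj₁ (apex i 0F))) +
    (s * (suc (R + R) + (2 * V + (2 * s + 1))) + (ℓ′ (inj₂ (axle i 1F)) + ℓ′ (inj₁ hub)))
      ≡⟨ apexColour₁ E F O H r (toℕ i) (toℕ (opposite i))
           (s * (suc (R + R) + (2 * V + (2 * s + 1)))) (1+toℕ+opposite i) ⟩
    β ∎
    where open ≡-Reasoning

  private
    overApexes : ∀ k b → sum (λ i → term (rim k b) (apex i 0F) + term (rim k b) (apex i 1F)) ≡ column k b + A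
    overApexes k b = trans
      (sum-cong-≗ λ i → trans
        (cong₂ _+_ (joined (cross i 0F k b) (inj₂ refl)) (joined (cross i 1F k b) (inj₂ refl)))
        (+-interchange (ℓ′ (inj₂ (cross i 0F k b))) _ _ _))
      (trans (∑-distrib-+ (λ i → ℓ′ (inj₂ (cross i 0F k b)) + ℓ′ (inj₂ (cross i 1F k b))) _)
             (cong₂ _+_ (sym (column≡ k b)) (sym A≡)))

  rim₀-colour : ∀ {Z} k → column k 0F + 2 * toℕ k ≡ Z →
    f⁺tn G f ⟦ rim k 0F ⟧ ≡ A + (Z + (2 * C + 2 * V + D + H) + (2 * s + 2 * s + 5))
  -- The arc at xₖ carries the index of the preceding column, so `k` is presented as a successor.
  rim₀-colour {Z} k column≡ = lemma (prev k) (next-prev k) column≡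
    where
    open ≡-Reasoning
    lemma : ∀ {k} m → next m ≡ k → column k 0F + 2 * toℕ k ≡ Z →
      f⁺tn G f ⟦ rim k 0F ⟧ ≡ A + (Z + (2 * C + 2 * V + D + H) + (2 * s + 2 * s + 5))
    lemma {k} m refl column≡ = begin
      f⁺tn G f ⟦ rim k 0F ⟧
        ≡⟨ f⁺tn-terms (rim k 0F) ⟩
      sum (λ i → term (rim k 0F) (apex i 0F) + term (rim k 0F) (apex i 1F)) +
      (sum (λ l → term (rim k 0F) (rim l 0F) + term (rim k 0F) (rim l 1F)) + term (rim k 0F) hub)
        ≡⟨ cong₂ _+_ (overApexes k 0F) (cong₂ _+_
             (trans (sum-only₂ m k (next≢id m ∘ sym) λ l l≢m l≢k →
                       cong₂ _+_ (apart-rim k l 0F) (apart-rim₀₁ k l (l≢k ∘ sym) (l≢m ∘ sym ∘ next-injective)))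
                    (cong₂ _+_ (+-nullˡ (apart-rim k m 0F) (joined (arc m) (inj₁ refl)))
                               (+-nullˡ (apart-rim k k 0F) (joined (rung k) (inj₁ refl)))))
             (joined (spoke k 0F) (inj₁ refl))) ⟩
      (column k 0F + A) +
      (((ℓ′ (inj₂ (arc m)) + ℓ′ (inj₁ (rim m 1F))) + (ℓ′ (inj₂ (rung k)) + ℓ′ (inj₁ (rim k 1F)))) +
       (ℓ′ (inj₂ (spoke k 0F)) + ℓ′ (inj₁ hub)))
        ≡⟨ rimColour₀ A C V D H s (toℕ m) (toℕ (opposite m)) (toℕ k) (toℕ (opposite k)) (column k 0F) Z
             (1+toℕ+opposite m) (1+toℕ+opposite k) column≡ ⟩
      A + (Z + (2 * C + 2 * V + D + H) + (2 * s + 2 * s + 5)) ∎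

  rim₁-colour : ∀ {Z} m → column m 1F + 2 * toℕ (opposite m) ≡ Z →
    f⁺tn G f ⟦ rim m 1F ⟧ ≡ A + (Z + (2 * C + 2 * V + D + H) + (2 * s + 2 * s + 4))
  rim₁-colour {Z} m column≡ = begin
    f⁺tn G f ⟦ rim m 1F ⟧
      ≡⟨ f⁺tn-terms (rim m 1F) ⟩
    sum (λ i → term (rim m 1F) (apex i 0F) + term (rim m 1F) (apex i 1F)) +
    (sum (λ l → term (rim m 1F) (rim l 0F) + term (rim m 1F) (rim l 1F)) + term (rim m 1F) hub)
      ≡⟨ cong₂ _+_ (overApexes m 1F) (cong₂ _+_
           -- On the rim, yₘ meets xₘ by a rung and the x of column `k` by an arc.
           (trans (sum-only₂ m k (next≢id m ∘ sym) λ l l≢m l≢k →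
                     cong₂ _+_ (apart-rim₁₀ m l l≢m l≢k) (apart-rim m l 1F))
                  (cong₂ _+_ (+-nullʳ (joined (rung m) (inj₂ refl)) (apart-rim m m 1F))
                             (+-nullʳ (joined (arc m) (inj₂ refl)) (apart-rim m k 1F))))
           (joined (spoke m 1F) (inj₁ refl))) ⟩
    (column m 1F + A) +
    (((ℓ′ (inj₂ (rung m)) + ℓ′ (inj₁ (rim m 0F))) + (ℓ′ (inj₂ (arc m)) + ℓ′ (inj₁ (rim k 0F)))) +
     (ℓ′ (inj₂ (spoke m 1F)) + ℓ′ (inj₁ hub)))
      ≡⟨ rimColour₁ A C V D H s (toℕ m) (toℕ (opposite m)) (toℕ k) (toℕ (opposite k)) (column m 1F) Z
           (1+toℕ+opposite m) (1+toℕ+opposite k) column≡ ⟩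
    A + (Z + (2 * C + 2 * V + D + H) + (2 * s + 2 * s + 4)) ∎
    where
    open ≡-Reasoning
    k : Fin s
    k = next m

  opaque
    -- The colour of the hub stays sealed; a lower bound suffices to place it above the others.
    θ : ℕ
    θ = f⁺tn G f ⟦ hub ⟧

    hub-colour : f⁺tn G f ⟦ hub ⟧ ≡ θ
    hub-colour = refl

  -- Axles and spokes are estimated by the starts `O` and `D` of their segments; the vertex labels
  -- are counted exactly.
  hub-colour≥ : r * (2 * suc O) + A + s * (2 * suc D + (2 * V + (2 * s + 1))) ≤ θ
  hub-colour≥ = begin
    r * (2 * suc O) + A + s * (2 * suc D + (2 * V + (2 * s + 1)))
      ≤⟨ ℕₚ.+-mono-≤ (ℕₚ.+-monoˡ-≤ A (sum-≥ (2 * suc O) axles≥)) (sum-≥ _ spokes≥) ⟩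
    sum axles + A + sum spokes
      ≡⟨ cong₂ _+_
           (trans (cong (sum axles +_) A≡)
             (trans (sym (∑-distrib-+ axles (λ i → ℓ′ (inj₁ (apex i 0F)) + ℓ′ (inj₁ (apex i 1F)))))
                    (sum-cong-≗ λ i → trans (+-interchange (ℓ′ (inj₂ (axle i 0F))) _ _ _)
                      (sym (cong₂ _+_ (joined (axle i 0F) (inj₂ refl)) (joined (axle i 1F) (inj₂ refl)))))))
           (sym (+-nullʳ
             (sum-cong-≗ λ k → cong₂ _+_ (joined (spoke k 0F) (inj₂ refl)) (joined (spoke k 1F) (inj₂ refl)))
             apart-hub)) ⟩
    sum (λ i → term hub (apex i 0F) + term hub (apex i 1F)) +
    (sum (λ k → term hub (rim k 0F) + term hub (rim k 1F)) + term hub hub)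
      ≡⟨ trans (sym (f⁺tn-terms hub)) hub-colour ⟩
    θ ∎
    where
    open ℕₚ.≤-Reasoning
    axles : Fin r → ℕ
    axles i = ℓ′ (inj₂ (axle i 0F)) + ℓ′ (inj₂ (axle i 1F))
    spokes : Fin s → ℕ
    spokes k = (ℓ′ (inj₂ (spoke k 0F)) + ℓ′ (inj₁ (rim k 0F))) + (ℓ′ (inj₂ (spoke k 1F)) + ℓ′ (inj₁ (rim k 1F)))
    twice : ∀ x a b → 2 * suc x ≤ suc (x + a) + suc (x + b)
    twice x a b = ℕₚ.+-mono-≤ (ℕ.s≤s (ℕₚ.m≤m+n x a))
      (ℕₚ.≤-trans (ℕₚ.≤-reflexive (ℕₚ.+-identityʳ (suc x))) (ℕ.s≤s (ℕₚ.m≤m+n x b)))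
    axles≥ : ∀ i → 2 * suc O ≤ axles i
    axles≥ i = twice O _ _
    spokes≥ : ∀ k → 2 * suc D + (2 * V + (2 * s + 1)) ≤ spokes k
    spokes≥ k = begin
      2 * suc D + (2 * V + (2 * s + 1))
        ≤⟨ ℕₚ.+-mono-≤ (twice D _ _)
             (ℕₚ.≤-reflexive (sym (rimPair V s (toℕ k) (toℕ (opposite k)) (1+toℕ+opposite k)))) ⟩
      (ℓ′ (inj₂ (spoke k 0F)) + ℓ′ (inj₂ (spoke k 1F))) + (ℓ′ (inj₁ (rim k 0F)) + ℓ′ (inj₁ (rim k 1F)))
        ≡⟨ +-interchange (ℓ′ (inj₂ (spoke k 0F))) _ _ _ ⟩
      spokes k ∎

  A≥ : r * (2 * F + 3) ≤ A
  A≥ = subst (r * (2 * F + 3) ≤_) (sym A≡) (sum-≥ {r} _ λ i →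
    ℕₚ.≤-trans (ℕₚ.m≤m+n (2 * F + 3) _) (ℕₚ.≤-reflexive (sym (apexPair F (toℕ (opposite i))))))

  A≤ : ∀ {w} → r ≤ suc w → A ≤ r * (2 * F + 3 + 4 * w)
  A≤ {w} r≤ = subst (_≤ r * (2 * F + 3 + 4 * w)) (sym A≡) (sum-≤ {r} _ λ i →
    ℕₚ.≤-trans (ℕₚ.≤-reflexive (apexPair F (toℕ (opposite i))))
      (ℕₚ.+-monoʳ-≤ (2 * F + 3) (ℕₚ.*-monoʳ-≤ 4 (ℕ.s≤s⁻¹ (ℕₚ.≤-trans (Finₚ.toℕ<n (opposite i)) r≤)))))

-- In each inequality below, the summand suc (…) is the difference of the two sides,
-- which is a polynomial with natural coefficients.
≡⇒< : ∀ {x y} p → x + suc p ≡ y → x < y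
≡⇒< {x} p refl = ℕₚ.m<m+n x ℕ.z<s

-- Separation of the colours by polynomial inequalities.

opaque
  unfolding Layout.R

  -- The case r ≥ s, parametrised by s = u + 2 and r = s + t. Only the larger side involves `A`, so
  -- its lower bound is used.
  apex<rim : ∀ u t → let open Bounds (suc u + t) (suc (suc u)) in β < A⁻ + ξ₀
  apex<rim u t = ≡⇒< _ (lemma u t)
    where
    lemma : ∀ u t →
      let w = suc u + t; r = suc w; s = suc (suc u); R = r * (2 * s)
          F = R + R; V = F + r * 2; H = V + s * 2; C = H + 1; D = C + s * 2; E = D + s * 2; O = E + r
      in suc r + (E + F + O + H + (2 * r + 2) + s * (suc (R + R) + (2 * V + (2 * s + 1))))
         + suc (15 + 60 * t + 24 * t * t + 9 * u + 51 * u * t + 12 * u * t * t + u * u + 12 * u * u * t)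
         ≡ r * (2 * F + 3) + (R + R + w * suc (R + (s + w * (2 * s))) + (2 * C + 2 * V + D + H) + (2 * s + 2 * s + 5))
    lemma = solve-∀

  -- The case r < s, parametrised by r = w + 1 and s = r + 1 + t. Now `A` is on the smaller side, so
  -- its upper bound is used.
  rim<apex : ∀ w t → let open Bounds w (suc (suc (w + t))) in A⁺ + η₀ < α
  rim<apex w t = ≡⇒< _ (lemma w t)
    where
    lemma : ∀ w t →
      let r = suc w; s = suc (suc (w + t)); R = r * (2 * s)
          F = R + R; V = F + r * 2; H = V + s * 2; C = H + 1; D = C + s * 2; E = D + s * 2; O = E + r
      in r * (2 * F + 3 + 4 * w) + (R + R + s + s + w * suc (R + R + s) + (2 * C + 2 * V + D + H) + (2 * s + 2 * s + 4))
         + suc (14 + 40 * t + 14 * t * t + 19 * w + 47 * w * t + 12 * w * t * t + 5 * w * w + 12 * w * w * t)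
         ≡ E + F + O + H + (2 * r + 2) + s * (suc (R + R) + (2 * V + (2 * s + 1)))
    lemma = solve-∀

  apex<hub : ∀ w u → let open Bounds w (suc (suc u)) in β < θ₁ + A⁻ + θ₂
  apex<hub w u = ≡⇒< _ (lemma w u)
    where
    lemma : ∀ w u →
      let r = suc w; s = suc (suc u); R = r * (2 * s)
          F = R + R; V = F + r * 2; H = V + s * 2; C = H + 1; D = C + s * 2; E = D + s * 2; O = E + r
      in suc r + (E + F + O + H + (2 * r + 2) + s * (suc (R + R) + (2 * V + (2 * s + 1))))
         + suc (55 + 53 * u + 12 * u * u + 89 * w + 48 * w * u + 4 * w * u * u + 38 * w * w + 16 * w * w * u)
         ≡ r * (2 * suc O) + r * (2 * F + 3) + s * (2 * suc D + (2 * V + (2 * s + 1)))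
    lemma = solve-∀

  -- The term `A` is common to η and to the bound for the hub, hence dropped from both.
  rim₁<hub : ∀ w u → let open Bounds w (suc (suc u)) in η₀ < θ₁ + θ₂
  rim₁<hub w u = ≡⇒< _ (lemma w u)
    where
    lemma : ∀ w u →
      let r = suc w; s = suc (suc u); R = r * (2 * s)
          F = R + R; V = F + r * 2; H = V + s * 2; C = H + 1; D = C + s * 2; E = D + s * 2; O = E + r
      in (R + R + s + s + w * suc (R + R + s) + (2 * C + 2 * V + D + H) + (2 * s + 2 * s + 4))
         + suc (72 + 93 * u + 26 * u * u + 73 * w + 67 * w * u + 16 * w * u * u + 14 * w * w + 4 * w * w * u)
         ≡ r * (2 * suc O) + s * (2 * suc D + (2 * V + (2 * s + 1)))
    lemma = solve-∀

  -- The difference is 2rs - 1: each of the r rows contributes 2s, and the constants 5 and 4 take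
  -- away 1.
  rim₀<rim₁ : ∀ w u → let open Bounds w (suc (suc u)) in ξ₀ < η₀
  rim₀<rim₁ w u = ≡⇒< _ (lemma w u)
    where
    lemma : ∀ w u →
      let r = suc w; s = suc (suc u); R = r * (2 * s)
          F = R + R; V = F + r * 2; H = V + s * 2; C = H + 1; D = C + s * 2; E = D + s * 2; O = E + r
      in (R + R + w * suc (R + (s + w * (2 * s))) + (2 * C + 2 * V + D + H) + (2 * s + 2 * s + 5))
         + suc (2 + 2 * u + 4 * w + 2 * w * u)
         ≡ (R + R + s + s + w * suc (R + R + s) + (2 * C + 2 * V + D + H) + (2 * s + 2 * s + 4))
    lemma = solve-∀

-- The five colours and the clique that forces them, for r = w + 1 and s = u + 2.

module _ (w u : ℕ) where

  private
    s : ℕ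
    s = suc (suc u)

  open Colours (suc w) s next≢
  open Bounds w s using (Z₀; Z₁; A⁻; A⁺; ξ₀; η₀; θ₁; θ₂)
  open Graph G using (_~_; NoIsolatedVertices)

  clique : AllPairs _~_ (⟦ apex 0F 0F ⟧ ∷ ⟦ apex 0F 1F ⟧ ∷ ⟦ rim 0F 0F ⟧ ∷ ⟦ rim 0F 1F ⟧ ∷ ⟦ hub ⟧ ∷ [])
  clique =
    (ends-adjacent (link 0F) All.∷ ends-adjacent (cross 0F 0F 0F 0F) All.∷
      ends-adjacent (cross 0F 0F 0F 1F) All.∷ ends-adjacent (axle 0F 0F) All.∷ All.[]) AllPairs.∷
    (ends-adjacent (cross 0F 1F 0F 0F) All.∷ ends-adjacent (cross 0F 1F 0F 1F) All.∷
      ends-adjacent (axle 0F 1F) All.∷ All.[]) AllPairs.∷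
    (ends-adjacent (rung 0F) All.∷ ends-adjacent (spoke 0F 0F) All.∷ All.[]) AllPairs.∷
    (ends-adjacent (spoke 0F 1F) All.∷ All.[]) AllPairs.∷
    All.[] AllPairs.∷ AllPairs.[]

  noIsolated : NoIsolatedVertices
  noIsolated (inj₁ _) = inj₂ 0F , _
  noIsolated (inj₂ _) = inj₁ (0F , 0F) , _

  private
    ξ η : ℕ
    ξ = A + ξ₀
    η = A + η₀

    colour : W → ℕ
    colour (apex i 0F) = α
    colour (apex i 1F) = β
    colour (rim k 0F)  = ξ
    colour (rim k 1F)  = η
    colour hub         = θ

    f⁺tn≡colour : ∀ v → f⁺tn G f ⟦ v ⟧ ≡ colour v
    f⁺tn≡colour (apex i 0F) = apex₀-colour i
    f⁺tn≡colour (apex i 1F) = apex₁-colour i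
    f⁺tn≡colour (rim k 0F)  = rim₀-colour k (columnSum₀ w s k)
    f⁺tn≡colour (rim k 1F)  = rim₁-colour k (columnSum₁ w s k)
    f⁺tn≡colour hub         = hub-colour

    α<β : α < β
    α<β = ℕₚ.m<n+m α {suc (suc w)} ℕ.z<s

    ξ<η : ξ < η
    ξ<η = ℕₚ.+-monoʳ-< A (rim₀<rim₁ w u)

    β<θ : β < θ
    β<θ = ℕₚ.<-≤-trans (apex<hub w u)
      (ℕₚ.≤-trans (ℕₚ.+-monoˡ-≤ θ₂ (ℕₚ.+-monoʳ-≤ θ₁ A≥)) hub-colour≥)

    η<θ : η < θ
    η<θ = ℕₚ.<-≤-trans (ℕₚ.+-monoʳ-< A (rim₁<hub w u))
      (ℕₚ.≤-trans (ℕₚ.≤-reflexive (swapˡ A θ₁ θ₂)) hub-colour≥)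
      where
      swapˡ : ∀ a b c → a + (b + c) ≡ b + a + c
      swapˡ = solve-∀

    β<ξ⊎η<α : β < ξ ⊎ η < α
    -- Since r = w + 1 and s = u + 2, `suc u ≤ w` says s ≤ r.
    β<ξ⊎η<α with ℕₚ.≤-<-connex (suc u) w
    ... | inj₁ u<w = let t , u+t≡w = ℕₚ.m≤n⇒∃[o]m+o≡n u<w in
      inj₁ (ℕₚ.<-≤-trans
        (subst (λ w → Bounds.β w s < Bounds.A⁻ w s + Bounds.ξ₀ w s) u+t≡w (apex<rim u t))
        (ℕₚ.+-monoˡ-≤ ξ₀ A≥))
    ... | inj₂ w≤u = let t , w+t≡u = ℕₚ.m≤n⇒∃[o]m+o≡n (ℕ.s≤s⁻¹ w≤u) in
      inj₂ (ℕₚ.≤-<-trans (ℕₚ.+-monoˡ-≤ η₀ (A≤ ℕₚ.≤-refl))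
        (subst (λ u → let s = suc (suc u) in Bounds.A⁺ w s + Bounds.η₀ w s < Bounds.α w s) w+t≡u (rim<apex w t)))

    apex≢rim : (α ≢ ξ × α ≢ η) × (β ≢ ξ × β ≢ η)
    apex≢rim with β<ξ⊎η<α
    ... | inj₁ β<ξ = (ℕₚ.<⇒≢ α<ξ , ℕₚ.<⇒≢ (ℕₚ.<-trans α<ξ ξ<η)) , (ℕₚ.<⇒≢ β<ξ , ℕₚ.<⇒≢ (ℕₚ.<-trans β<ξ ξ<η))
      where
      α<ξ : α < ξ
      α<ξ = ℕₚ.<-trans α<β β<ξ
    ... | inj₂ η<α = (ℕₚ.>⇒≢ (ℕₚ.<-trans ξ<η η<α) , ℕₚ.>⇒≢ η<α) , (ℕₚ.>⇒≢ (ℕₚ.<-trans ξ<η η<β) , ℕₚ.>⇒≢ η<β)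
      where
      η<β : η < β
      η<β = ℕₚ.<-trans η<α α<β

    ends-coloured : ∀ e → colour (proj₁ (ends e)) ≢ colour (proj₂ (ends e))
    ends-coloured (link i)          = ℕₚ.<⇒≢ α<β
    ends-coloured (cross i 0F k 0F) = proj₁ (proj₁ apex≢rim)
    ends-coloured (cross i 0F k 1F) = proj₂ (proj₁ apex≢rim)
    ends-coloured (cross i 1F k 0F) = proj₁ (proj₂ apex≢rim)
    ends-coloured (cross i 1F k 1F) = proj₂ (proj₂ apex≢rim)
    ends-coloured (axle i 0F)       = ℕₚ.<⇒≢ (ℕₚ.<-trans α<β β<θ)
    ends-coloured (axle i 1F)       = ℕₚ.<⇒≢ β<θ
    ends-coloured (rung k)          = ℕₚ.<⇒≢ ξ<η
    ends-coloured (arc k)           = ℕₚ.<⇒≢ ξ<η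
    ends-coloured (spoke k 0F)      = ℕₚ.<⇒≢ (ℕₚ.<-trans ξ<η η<θ)
    ends-coloured (spoke k 1F)      = ℕₚ.<⇒≢ η<θ

    joined-coloured : ∀ {e x y} → Joins e x y → colour x ≢ colour y
    joined-coloured {e} (inj₁ refl) = ends-coloured e
    joined-coloured {e} (inj₂ refl) = ends-coloured e ∘ sym

    named : ∀ v → ∃[ x ] ⟦ x ⟧ ≡ v
    named v = Inverse.from W↔V v , Inverse.strictlyInverseˡ W↔V v

    colours : List ℕ
    colours = α ∷ β ∷ ξ ∷ η ∷ θ ∷ []

    colour∈ : ∀ x → colour x ∈ colours
    colour∈ (apex i 0F) = here refl
    colour∈ (apex i 1F) = there (here refl)
    colour∈ (rim k 0F)  = there (there (here refl))
    colour∈ (rim k 1F)  = there (there (there (here refl)))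
    colour∈ hub         = there (there (there (there (here refl))))

  antimagic : IsLocalTotalNeighborhoodAntimagic G f
  antimagic {a} {b} = lemma (named a) (named b)
    where
    lemma : ∀ {a b} → ∃[ x ] ⟦ x ⟧ ≡ a → ∃[ y ] ⟦ y ⟧ ≡ b → a ~ b → f⁺tn G f a ≢ f⁺tn G f b
    lemma (x , refl) (y , refl) x~y eq =
      joined-coloured {e} j (trans (sym (f⁺tn≡colour x)) (trans eq (f⁺tn≡colour y)))
      where
      e = proj₁ (adjacent⇒joins x y x~y)
      j = proj₂ (adjacent⇒joins x y x~y)

  χltna≡5 : χltna G is 5
  χltna≡5 = χltna-by-clique noIsolated clique f (λ {a} {b} → antimagic {a} {b}) (λ v → f⁺tn∈ (named v)) refl
    where
    f⁺tn∈ : ∀ {v} → ∃[ x ] ⟦ x ⟧ ≡ v → f⁺tn G f v ∈ colours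
    f⁺tn∈ (x , refl) = subst (_∈ colours) (sym (f⁺tn≡colour x)) (colour∈ x)

theorem2p6 : ∀ (r s : ℕ) → r ≥ 1 → s ≥ 2 → χltna (r copiesOf K 2) ∨ Wheel s is 5
theorem2p6 (suc w) (suc (suc u)) _ _ = χltna≡5 w u
theorem2p6 zero    _             () _
theorem2p6 _       zero          _ ()
theorem2p6 _       (suc zero)    _ (ℕ.s≤s ())
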